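{- Let $M\ge N\ge 1$ and $1\le E\le D$ be integers. Let $[A]_{D+E}=[A]_D+[\Delta A]_E\,t^D$ with $[A]_D=\sum_{d=0}^{D-1}A_dt^d$, $[\Delta A]_E=\sum_{d=0}^{E-1}A_{D+d}t^d$ and $A_d\in\mathbb R^{M\times N}$. Let $[Q]_D=\sum_{d=0}^{D-1}Q_dt^d$ ($Q_d\in\mathbb R^{M\times N}$) and $[R]_D=\sum_{d=0}^{D-1}R_dt^d$ ($R_d\in\mathbb R^{N\times N}$) satisfy $$[Q]_D[R]_D\stackrel{D}{=}[A]_D,\qquad [Q]_D^T[Q]_D\stackrel{D}{=}I,\qquad P_L\circ[R]_D\stackrel{D}{=}0,$$ and assume that $R_0$ is invertible. Define successively: 1. $[\Delta F]_E$ and $[\Delta G]_E$ by $[\Delta F]_E\,t^D\stackrel{D+E}{=}[Q]_D[R]_D-[A]_D$ and $[\Delta G]_E\,t^D\stackrel{D+E}{=}I-[Q]_D^T[Q]_D$; 2. $[H]_E\stackrel{E}{=}[\Delta A]_E-[\Delta F]_E$ and $[S]_E\stackrel{E}{=}\tfrac12[\Delta G]_E$; 3. $[X]_E$ as the antisymmetric matrix polynomial ($[X]_E^T=-[X]_E$) determined by $P_L\circ[X]_E\stackrel{E}{=}P_L\circ\big([Q]_E^T[H]_E[R]_E^{ -1}\big)-P_L\circ[S]_E$; 4. $[K]_E\stackrel{E}{=}[S]_E+[X]_E$; 5. $[\Delta R]_E\stackrel{E}{=}[Q]_E^T[H]_E-[K]_E[R]_E$; 6. $[\Delta Q]_E\stackrel{E}{=}\big([H]_E-[Q]_E[\Delta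 R]_E\big)[R]_E^{ -1}$. Then $[Q]_{D+E}:=[Q]_D+[\Delta Q]_E\,t^D$ and $[R]_{D+E}:=[R]_D+[\Delta R]_E\,t^D$ satisfy $$[Q]_{D+E}[R]_{D+E}\stackrel{D+E}{=}[A]_{D+E},\qquad [Q]_{D+E}^T[Q]_{D+E}\stackrel{D+E}{=}I,\qquad P_L\circ[R]_{D+E}\stackrel{D+E}{=}0 .$$
   Context: For polynomials (or power series) in $t$ with matrix coefficients, $\stackrel{D}{=}$ means equality of the coefficients of $t^0,\dots,t^{D-1}$, i.e. equality modulo $t^D$. $[X]_D$ denotes a matrix polynomial of degree at most $D-1$ in $t$ with real matrix coefficients, representing an element modulo $t^D$. For $E\le D$, $[X]_E$ denotes the truncation of $[X]_D$ modulo $t^E$. $[R]_E^{ -1}$ is the inverse of $[R]_E$ modulo $t^E$. The transpose and the Hadamard (entrywise) product $\circ$ with a constant matrix act coefficientwise. $P_L\in\mathbb R^{N\times N}$ is the matrix with $(P_L)_{ij}=1$ if $i>j$ and $0$ otherwise, so $P_L\circ R=0$ means that $R$ is upper triangular. $I$ is the $N\times N$ identity matrix. -}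

module Defs where

open import Algebra.Bundles using (CommutativeRing)
import Algebra.Properties.Semiring.Sum as SemiringSum
open import Data.Bool.Base using (if_then_else_)
open import Data.Fin.Base using (Fin; toℕ; fromℕ<; inject≤)
import Data.Fin.Properties as Fin
open import Data.Nat.Base as ℕ using (ℕ; zero; suc; _∸_; _⊔_)
import Data.Nat.Properties as ℕ
open import Data.Product.Base using (∃-syntax; _×_; _,_; proj₁; proj₂)
open import Data.Rational.Base as ℚ using (ℚ; 0ℚ; 1ℚ; ½; ∣_∣)
import Data.Rational.Properties as ℚ
open import Data.Rational.Solver using (module +-*-Solver)
open import Data.Vec.Functional using (Vector; transpose)
open import Level using (0ℓ)
open import Relation.Binary.PropositionalEquality
open import Relation.Binary.Structures using (IsEquivalence)
open import Relation.Nullary.Decidable using (does; yes; no)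

-- The real numbers, as Cauchy sequences of rationals.  The equality of
-- reals is the setoid equality _≃_ : the difference tends to zero.

record ℝ : Set where
  no-eta-equality
  field
    seq    : ℕ → ℚ
    cauchy : ∀ ε → 0ℚ ℚ.< ε → ∃[ n₀ ] (∀ m n → n₀ ℕ.≤ m → n₀ ℕ.≤ n →
             ∣ seq m ℚ.- seq n ∣ ℚ.< ε)

open ℝ public

infix 4 _≃_

record _≃_ (x y : ℝ) : Set where
  no-eta-equality
  constructor mk≃
  field
    close : ∀ ε → 0ℚ ℚ.< ε → ∃[ n₀ ] (∀ n → n₀ ℕ.≤ n →
            ∣ seq x n ℚ.- seq y n ∣ ℚ.< ε)

open _≃_ public

private

  ½ε : ℚ → ℚ
  ½ε ε = ½ ℚ.* ε

  ½ε>0 : ∀ {ε} → 0ℚ ℚ.< ε → 0ℚ ℚ.< ½ε ε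
  ½ε>0 {ε} ε>0 = subst (ℚ._< ½ε ε) (ℚ.*-zeroʳ ½) (ℚ.*-monoʳ-<-pos ½ ε>0)

  ½ε+½ε : ∀ ε → ½ε ε ℚ.+ ½ε ε ≡ ε
  ½ε+½ε ε = trans (sym (ℚ.*-distribʳ-+ ε ½ ½)) (ℚ.*-identityˡ ε)

  ∣p-p∣<ε : ∀ p {ε} → 0ℚ ℚ.< ε → ∣ p ℚ.- p ∣ ℚ.< ε
  ∣p-p∣<ε p ε>0 rewrite ℚ.+-inverseʳ p = ε>0

  ∣-∣-sym : ∀ p q → ∣ p ℚ.- q ∣ ≡ ∣ q ℚ.- p ∣
  ∣-∣-sym p q = trans (cong ∣_∣ (solve 2 (λ p q → p :- q := :- (q :- p)) refl p q))
                      (ℚ.∣-p∣≡∣p∣ (q ℚ.- p))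
    where open +-*-Solver

  add-close : ∀ {u v w ε} → w ≡ u ℚ.+ v → ∣ u ∣ ℚ.< ½ε ε → ∣ v ∣ ℚ.< ½ε ε →
              ∣ w ∣ ℚ.< ε
  add-close {u} {v} {w} {ε} refl u< v< = begin-strict
    ∣ u ℚ.+ v ∣      ≤⟨ ℚ.∣p+q∣≤∣p∣+∣q∣ u v ⟩
    ∣ u ∣ ℚ.+ ∣ v ∣  <⟨ ℚ.+-mono-< u< v< ⟩
    ½ε ε ℚ.+ ½ε ε    ≡⟨ ½ε+½ε ε ⟩
    ε                ∎
    where open ℚ.≤-Reasoning

  scaled : ℚ → (B : ℚ) → .{{ℚ.Positive B}} → ℚ
  scaled ε B = (ℚ.1/ B) {{ℚ.pos⇒nonZero B}} ℚ.* ½ε ε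

  scaled>0 : ∀ {ε} → 0ℚ ℚ.< ε → ∀ B .{{_ : ℚ.Positive B}} → 0ℚ ℚ.< scaled ε B
  scaled>0 {ε} ε>0 B = subst (ℚ._< scaled ε B) (ℚ.*-zeroʳ B⁻¹)
    (ℚ.*-monoʳ-<-pos B⁻¹ {{ℚ.1/pos⇒pos B}} (½ε>0 ε>0))
    where
    B⁻¹ : ℚ
    B⁻¹ = (ℚ.1/ B) {{ℚ.pos⇒nonZero B}}

  scaled-cancel : ∀ ε B .{{_ : ℚ.Positive B}} → B ℚ.* scaled ε B ≡ ½ε ε
  scaled-cancel ε B = trans (sym (ℚ.*-assoc B _ (½ε ε)))
    (trans (cong (ℚ._* ½ε ε) (ℚ.*-inverseʳ B {{ℚ.pos⇒nonZero B}}))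
           (ℚ.*-identityˡ (½ε ε)))

  mul-small : ∀ ε B .{{_ : ℚ.Positive B}} p q → ∣ p ∣ ℚ.≤ B → ∣ q ∣ ℚ.< scaled ε B →
              ∣ p ℚ.* q ∣ ℚ.< ½ε ε
  mul-small ε B p q p≤ q< = begin-strict
    ∣ p ℚ.* q ∣      ≡⟨ ℚ.∣p*q∣≡∣p∣*∣q∣ p q ⟩
    ∣ p ∣ ℚ.* ∣ q ∣  ≤⟨ ℚ.*-monoʳ-≤-nonNeg ∣ q ∣ {{ℚ.∣-∣-nonNeg q}} p≤ ⟩
    B ℚ.* ∣ q ∣      <⟨ ℚ.*-monoʳ-<-pos B q< ⟩
    B ℚ.* scaled ε B ≡⟨ scaled-cancel ε B ⟩
    ½ε ε             ∎
    where open ℚ.≤-Reasoning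

  mul-close : ∀ {ε B C} .{{_ : ℚ.Positive B}} .{{_ : ℚ.Positive C}} a b c d →
              ∣ a ∣ ℚ.≤ B → ∣ d ∣ ℚ.≤ C →
              ∣ b ℚ.- d ∣ ℚ.< scaled ε B → ∣ a ℚ.- c ∣ ℚ.< scaled ε C →
              ∣ a ℚ.* b ℚ.- c ℚ.* d ∣ ℚ.< ε
  mul-close {ε} {B} {C} a b c d a≤ d≤ bd ac = add-close
    (solve 4 (λ a b c d → a :* b :- c :* d := a :* (b :- d) :+ d :* (a :- c)) refl a b c d)
    (mul-small ε B a (b ℚ.- d) a≤ bd)
    (mul-small ε C d (a ℚ.- c) d≤ ac)
    where open +-*-Solver

  record Bound (x : ℝ) : Set where
    field
      B     : ℚ
      {{B>0}} : ℚ.Positive B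
      from  : ℕ
      bound : ∀ n → from ℕ.≤ n → ∣ seq x n ∣ ℚ.≤ B

  bounded : ∀ x → Bound x
  bounded x = record
    { B     = 1ℚ ℚ.+ ∣ p ∣
    ; B>0   = ℚ.pos+nonNeg⇒pos 1ℚ ∣ p ∣ {{ℚ.∣-∣-nonNeg p}}
    ; from  = n₀
    ; bound = λ n n₀≤n → let q = seq x n in begin
        ∣ q ∣                    ≡⟨ cong ∣_∣ (solve 2 (λ q p → q := (q :- p) :+ p) refl q p) ⟩
        ∣ (q ℚ.- p) ℚ.+ p ∣      ≤⟨ ℚ.∣p+q∣≤∣p∣+∣q∣ (q ℚ.- p) p ⟩
        ∣ q ℚ.- p ∣ ℚ.+ ∣ p ∣    ≤⟨ ℚ.+-monoˡ-≤ ∣ p ∣ (ℚ.<⇒≤ (near n n₀ n₀≤n ℕ.≤-refl)) ⟩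
        1ℚ ℚ.+ ∣ p ∣             ∎
    }
    where
    open ℚ.≤-Reasoning
    open +-*-Solver
    c : ∃[ n₀ ] (∀ m n → n₀ ℕ.≤ m → n₀ ℕ.≤ n → ∣ seq x m ℚ.- seq x n ∣ ℚ.< 1ℚ)
    c = cauchy x 1ℚ (ℚ.positive⁻¹ 1ℚ)
    n₀ : ℕ
    n₀ = proj₁ c
    near : ∀ m n → n₀ ℕ.≤ m → n₀ ℕ.≤ n → ∣ seq x m ℚ.- seq x n ∣ ℚ.< 1ℚ
    near = proj₂ c
    p : ℚ
    p = seq x n₀

  max₁ : ∀ {a b n} → a ⊔ b ℕ.≤ n → a ℕ.≤ n
  max₁ {a} {b} = ℕ.≤-trans (ℕ.m≤m⊔n a b)

  max₂ : ∀ {a b n} → a ⊔ b ℕ.≤ n → b ℕ.≤ n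
  max₂ {a} {b} = ℕ.≤-trans (ℕ.m≤n⊔m a b)

fromℚ : ℚ → ℝ
seq    (fromℚ p) _       = p
cauchy (fromℚ p) ε ε>0   = 0 , λ _ _ _ _ → ∣p-p∣<ε p ε>0

0ℝ 1ℝ ½ℝ : ℝ
0ℝ = fromℚ 0ℚ
1ℝ = fromℚ 1ℚ
½ℝ = fromℚ ½

infixl 6 _+ℝ_
infixl 7 _*ℝ_
infix  8 -ℝ_

_+ℝ_ : ℝ → ℝ → ℝ
seq    (x +ℝ y) n     = seq x n ℚ.+ seq y n
cauchy (x +ℝ y) ε ε>0 with cauchy x (½ε ε) (½ε>0 ε>0) | cauchy y (½ε ε) (½ε>0 ε>0)
... | a , p | b , q = a ⊔ b , λ m n ≤m ≤n → add-close
  (solve 4 (λ s t u v → (s :+ t) :- (u :+ v) := (s :- u) :+ (t :- v)) refl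
    (seq x m) (seq y m) (seq x n) (seq y n))
  (p m n (max₁ ≤m) (max₁ ≤n)) (q m n (max₂ ≤m) (max₂ ≤n))
  where open +-*-Solver

-ℝ_ : ℝ → ℝ
seq    (-ℝ x) n     = ℚ.- seq x n
cauchy (-ℝ x) ε ε>0 with cauchy x ε ε>0
... | a , p = a , λ m n ≤m ≤n → subst (λ r → ∣ r ∣ ℚ.< ε)
  (solve 2 (λ s t → s :- t := :- t :- (:- s)) refl (seq x n) (seq x m))
  (p n m ≤n ≤m)
  where open +-*-Solver

_*ℝ_ : ℝ → ℝ → ℝ
seq    (x *ℝ y) n     = seq x n ℚ.* seq y n
cauchy (x *ℝ y) ε ε>0 with bounded x | bounded y
... | bx | by
  with cauchy y (scaled ε (Bound.B bx)) (scaled>0 ε>0 (Bound.B bx))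
     | cauchy x (scaled ε (Bound.B by)) (scaled>0 ε>0 (Bound.B by))
... | a , p | b , q = (a ⊔ b) ⊔ (Bound.from bx ⊔ Bound.from by) , λ m n ≤m ≤n →
  mul-close {ε} {Bound.B bx} {Bound.B by} (seq x m) (seq y m) (seq x n) (seq y n)
    (Bound.bound bx m (max₁ (max₂ {a ⊔ b} ≤m)))
    (Bound.bound by n (max₂ {Bound.from bx} (max₂ {a ⊔ b} ≤n)))
    (p m n (max₁ (max₁ ≤m)) (max₁ (max₁ ≤n)))
    (q m n (max₂ {a} (max₁ ≤m)) (max₂ {a} (max₁ ≤n)))

private

  pointwise : ∀ {x y} → (∀ n → seq x n ≡ seq y n) → x ≃ y
  close (pointwise {x} {y} eq) ε ε>0 = 0 , λ n _ →
    subst (λ r → ∣ seq x n ℚ.- r ∣ ℚ.< ε) (eq n) (∣p-p∣<ε (seq x n) ε>0)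

  ≃-refl : ∀ {x} → x ≃ x
  ≃-refl = pointwise λ _ → refl

  ≃-sym : ∀ {x y} → x ≃ y → y ≃ x
  close (≃-sym {x} {y} x≃y) ε ε>0 with close x≃y ε ε>0
  ... | a , p = a , λ n ≤n → subst (ℚ._< ε) (∣-∣-sym (seq x n) (seq y n)) (p n ≤n)

  ≃-trans : ∀ {x y z} → x ≃ y → y ≃ z → x ≃ z
  close (≃-trans {x} {y} {z} x≃y y≃z) ε ε>0
    with close x≃y (½ε ε) (½ε>0 ε>0) | close y≃z (½ε ε) (½ε>0 ε>0)
  ... | a , p | b , q = a ⊔ b , λ n ≤n → add-close
    (solve 3 (λ s t u → s :- u := (s :- t) :+ (t :- u)) refl (seq x n) (seq y n) (seq z n))
    (p n (max₁ ≤n)) (q n (max₂ ≤n))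
    where open +-*-Solver

  +-cong : ∀ {x y u v} → x ≃ y → u ≃ v → x +ℝ u ≃ y +ℝ v
  close (+-cong {x} {y} {u} {v} x≃y u≃v) ε ε>0
    with close x≃y (½ε ε) (½ε>0 ε>0) | close u≃v (½ε ε) (½ε>0 ε>0)
  ... | a , p | b , q = a ⊔ b , λ n ≤n → add-close
    (solve 4 (λ s t u v → (s :+ t) :- (u :+ v) := (s :- u) :+ (t :- v)) refl
      (seq x n) (seq u n) (seq y n) (seq v n))
    (p n (max₁ ≤n)) (q n (max₂ ≤n))
    where open +-*-Solver

  -‿cong : ∀ {x y} → x ≃ y → -ℝ x ≃ -ℝ y
  close (-‿cong {x} {y} x≃y) ε ε>0 with close x≃y ε ε>0
  ... | a , p = a , λ n ≤n → subst (ℚ._< ε)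
    (trans (∣-∣-sym (seq x n) (seq y n)) (cong ∣_∣
      (solve 2 (λ s t → t :- s := :- s :- (:- t)) refl (seq x n) (seq y n))))
    (p n ≤n)
    where open +-*-Solver

  *-cong : ∀ {x y u v} → x ≃ y → u ≃ v → x *ℝ u ≃ y *ℝ v
  close (*-cong {x} {y} {u} {v} x≃y u≃v) ε ε>0 with bounded x | bounded v
  ... | bx | bv
    with close u≃v (scaled ε (Bound.B bx)) (scaled>0 ε>0 (Bound.B bx))
       | close x≃y (scaled ε (Bound.B bv)) (scaled>0 ε>0 (Bound.B bv))
  ... | a , p | b , q = (a ⊔ b) ⊔ (Bound.from bx ⊔ Bound.from bv) , λ n ≤n →
    mul-close {ε} {Bound.B bx} {Bound.B bv} (seq x n) (seq u n) (seq y n) (seq v n)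
      (Bound.bound bx n (max₁ (max₂ {a ⊔ b} ≤n)))
      (Bound.bound bv n (max₂ {Bound.from bx} (max₂ {a ⊔ b} ≤n)))
      (p n (max₁ (max₁ ≤n)))
      (q n (max₂ {a} (max₁ ≤n)))

  ≃-isEquivalence : IsEquivalence _≃_
  ≃-isEquivalence = record { refl = ≃-refl ; sym = ≃-sym ; trans = ≃-trans }

ℝ-commutativeRing : CommutativeRing 0ℓ 0ℓ
ℝ-commutativeRing = record
  { Carrier = ℝ
  ; _≈_     = _≃_
  ; _+_     = _+ℝ_
  ; _*_     = _*ℝ_
  ; -_      = -ℝ_
  ; 0#      = 0ℝ
  ; 1#      = 1ℝ
  ; isCommutativeRing = record
    { isRing = record
      { +-isAbelianGroup = record
        { isGroup = record
          { isMonoid = record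
            { isSemigroup = record
              { isMagma = record
                { isEquivalence = ≃-isEquivalence
                ; ∙-cong        = +-cong
                }
              ; assoc = λ x y z → pointwise λ n → ℚ.+-assoc (seq x n) (seq y n) (seq z n)
              }
            ; identity = (λ x → pointwise λ n → ℚ.+-identityˡ (seq x n))
                       , (λ x → pointwise λ n → ℚ.+-identityʳ (seq x n))
            }
          ; inverse = (λ x → pointwise λ n → ℚ.+-inverseˡ (seq x n))
                    , (λ x → pointwise λ n → ℚ.+-inverseʳ (seq x n))
          ; ⁻¹-cong = -‿cong
          }
        ; comm = λ x y → pointwise λ n → ℚ.+-comm (seq x n) (seq y n)
        }
      ; *-cong     = *-cong
      ; *-assoc    = λ x y z → pointwise λ n → ℚ.*-assoc (seq x n) (seq y n) (seq z n)
      ; *-identity = (λ x → pointwise λ n → ℚ.*-identityˡ (seq x n))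
                   , (λ x → pointwise λ n → ℚ.*-identityʳ (seq x n))
      ; distrib    = (λ x y z → pointwise λ n → ℚ.*-distribˡ-+ (seq x n) (seq y n) (seq z n))
                   , (λ x y z → pointwise λ n → ℚ.*-distribʳ-+ (seq x n) (seq y n) (seq z n))
      }
    ; *-comm = λ x y → pointwise λ n → ℚ.*-comm (seq x n) (seq y n)
    }
  }

-- A Series is a power series in t: its value at d is the coefficient of t ^ d.

module MatrixSeries {c ℓ} (𝕂 : CommutativeRing c ℓ) where

  open CommutativeRing 𝕂
    using (Carrier; _≈_; _+_; _*_; -_; 0#; 1#; semiring)
  open SemiringSum semiring using (sum; sum-syntax; sum⁺-syntax)

  Matrix : ℕ → ℕ → Set c
  Matrix m n = Vector (Vector Carrier n) m

  infix  4 _≈ᴹ_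
  infixl 7 _*ᴹ_ _∘ᴹ_

  _≈ᴹ_ : ∀ {m n} → Matrix m n → Matrix m n → Set ℓ
  A ≈ᴹ B = ∀ i j → A i j ≈ B i j

  0ᴹ : ∀ {m n} → Matrix m n
  0ᴹ _ _ = 0#

  1ᴹ : ∀ {n} → Matrix n n
  1ᴹ i j = if does (i Fin.≟ j) then 1# else 0#

  _*ᴹ_ : ∀ {m k n} → Matrix m k → Matrix k n → Matrix m n
  _*ᴹ_ {k = k} A B i j = ∑[ l < k ] (A i l * B l j)

  _∘ᴹ_ : ∀ {m n} → Matrix m n → Matrix m n → Matrix m n
  (A ∘ᴹ B) i j = A i j * B i j

  P-L : ∀ {n} → Matrix n n
  P-L i j = if does (j Fin.<? i) then 1# else 0#

  Invertible : ∀ {n} → Matrix n n → Set _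
  Invertible A = ∃[ B ] (A *ᴹ B ≈ᴹ 1ᴹ × B *ᴹ A ≈ᴹ 1ᴹ)

  Series : ℕ → ℕ → Set c
  Series m n = ℕ → Matrix m n

  infix  4 _≈[_]_
  infixl 6 _+ˢ_ _-ˢ_
  infixl 7 _*ˢ_ _∘ˢ_ _•ˢ_
  infix  8 -ˢ_
  infixl 9 _ᵀ _·t^_

  _≈[_]_ : ∀ {m n} → Series m n → ℕ → Series m n → Set ℓ
  X ≈[ D ] Y = ∀ d → d ℕ.< D → X d ≈ᴹ Y d

  0ˢ : ∀ {m n} → Series m n
  0ˢ _ = 0ᴹ

  1ˢ : ∀ {n} → Series n n
  1ˢ zero    = 1ᴹ
  1ˢ (suc _) = 0ᴹ

  _+ˢ_ : ∀ {m n} → Series m n → Series m n → Series m n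
  (X +ˢ Y) d i j = X d i j + Y d i j

  -ˢ_ : ∀ {m n} → Series m n → Series m n
  (-ˢ X) d i j = - X d i j

  _-ˢ_ : ∀ {m n} → Series m n → Series m n → Series m n
  X -ˢ Y = X +ˢ (-ˢ Y)

  _*ˢ_ : ∀ {m k n} → Series m k → Series k n → Series m n
  (X *ˢ Y) d i j = ∑[ e ≤ d ] (X (toℕ e) *ᴹ Y (d ∸ toℕ e)) i j

  _•ˢ_ : ∀ {m n} → Carrier → Series m n → Series m n
  (a •ˢ X) d i j = a * X d i j

  _∘ˢ_ : ∀ {m n} → Matrix m n → Series m n → Series m n
  (P ∘ˢ X) d = P ∘ᴹ X d

  _ᵀ : ∀ {m n} → Series m n → Series n m
  (X ᵀ) d = transpose (X d)

  _·t^_ : ∀ {m n} → Series m n → ℕ → Series m n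
  (X ·t^ D) d with D ℕ.≤? d
  ... | yes _ = X (d ∸ D)
  ... | no  _ = 0ᴹ

  -- [ X ]_D : polynomials of degree at most D - 1, by their coefficients.
  MatPoly : ℕ → ℕ → ℕ → Set c
  MatPoly D m n = Vector (Matrix m n) D

  ⟦_⟧ : ∀ {D m n} → MatPoly D m n → Series m n
  ⟦_⟧ {D} X d with d ℕ.<? D
  ... | yes d<D = X (fromℕ< d<D)
  ... | no  _   = 0ᴹ

  truncate : ∀ {D E m n} → E ℕ.≤ D → MatPoly D m n → MatPoly E m n
  truncate E≤D X d = X (inject≤ d E≤D)

open MatrixSeries ℝ-commutativeRing public

-- The successively defined quantities, each with its defining relation rather
-- than a closed formula.  That such quantities exist is a claim to be proved, not
-- part of this definition.  R⁻¹ is the inverse of [ R ]_E modulo t ^ E.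
record LiftingStep {M N D E : ℕ} (E≤D : E ℕ.≤ D)
                   (A : MatPoly D M N) (ΔA : MatPoly E M N)
                   (Q : MatPoly D M N) (R : MatPoly D N N) : Set where

  Q[E] : Series M N
  Q[E] = ⟦ truncate E≤D Q ⟧

  R[E] : Series N N
  R[E] = ⟦ truncate E≤D R ⟧

  field
    R⁻¹    : MatPoly E N N
    R-invʳ : R[E] *ˢ ⟦ R⁻¹ ⟧ ≈[ E ] 1ˢ
    R-invˡ : ⟦ R⁻¹ ⟧ *ˢ R[E] ≈[ E ] 1ˢ

    ΔF     : MatPoly E M N
    ΔF-def : ⟦ ΔF ⟧ ·t^ D ≈[ D ℕ.+ E ] ⟦ Q ⟧ *ˢ ⟦ R ⟧ -ˢ ⟦ A ⟧

    ΔG     : MatPoly E N N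
    ΔG-def : ⟦ ΔG ⟧ ·t^ D ≈[ D ℕ.+ E ] 1ˢ -ˢ ⟦ Q ⟧ ᵀ *ˢ ⟦ Q ⟧

    H      : MatPoly E M N
    H-def  : ⟦ H ⟧ ≈[ E ] ⟦ ΔA ⟧ -ˢ ⟦ ΔF ⟧

    S      : MatPoly E N N
    S-def  : ⟦ S ⟧ ≈[ E ] ½ℝ •ˢ ⟦ ΔG ⟧

    X      : MatPoly E N N
    X-anti : ⟦ X ⟧ ᵀ ≈[ E ] -ˢ ⟦ X ⟧
    X-def  : P-L ∘ˢ ⟦ X ⟧
               ≈[ E ] P-L ∘ˢ (Q[E] ᵀ *ˢ ⟦ H ⟧ *ˢ ⟦ R⁻¹ ⟧) -ˢ P-L ∘ˢ ⟦ S ⟧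

    K      : MatPoly E N N
    K-def  : ⟦ K ⟧ ≈[ E ] ⟦ S ⟧ +ˢ ⟦ X ⟧

    ΔR     : MatPoly E N N
    ΔR-def : ⟦ ΔR ⟧ ≈[ E ] Q[E] ᵀ *ˢ ⟦ H ⟧ -ˢ ⟦ K ⟧ *ˢ R[E]

    ΔQ     : MatPoly E M N
    ΔQ-def : ⟦ ΔQ ⟧ ≈[ E ] (⟦ H ⟧ -ˢ Q[E] *ˢ ⟦ ΔR ⟧) *ˢ ⟦ R⁻¹ ⟧

{-# OPTIONS --safe #-}
module Submission where

-- Since E ≤ D, the term ΔQ ΔR t²ᴰ vanishes modulo tᴰ⁺ᴱ, so lifting a product is
-- a linear problem for the corrections modulo tᴱ:
--   ΔQ R + Q ΔR ≈ H,   ΔQᵀ Q + Qᵀ ΔQ ≈ ΔG,   ΔR upper triangular.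
-- The first holds by the choice of ΔQ.  Since QᵀQ ≈ 1 modulo tᴱ, also Qᵀ ΔQ ≈ K,
-- whose symmetric part is S = ½ ΔG because X is antisymmetric and ΔG tᴰ ≈ 1 - QᵀQ
-- is symmetric.  Finally ΔR ≈ (QᵀHR⁻¹ - K) R, and X is chosen to
-- cancel the strictly lower part of QᵀHR⁻¹ - K.

open import Algebra.Bundles using (AbelianGroup; CommutativeRing)
import Algebra.Properties.AbelianGroup as AbelianGroupProperties
import Algebra.Properties.CommutativeSemigroup as CommutativeSemigroupProperties
import Algebra.Properties.Ring as RingProperties
import Algebra.Properties.Semiring.Sum as SemiringSum
open import Data.Bool.Base using (if_then_else_)
open import Data.Fin.Base as Fin using (Fin; toℕ; fromℕ<; inject≤; opposite)
import Data.Fin.Permutation as Permutation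
import Data.Fin.Properties as Fin
open import Data.Nat.Base as ℕ using (ℕ; zero; suc; _∸_; z<s)
import Data.Nat.Properties as ℕ
open import Data.Product.Base using (_×_; ∃-syntax; _,_; proj₁; proj₂)
open import Data.Vec.Functional using (transpose)
open import Defs using (module MatrixSeries)
open import Relation.Binary.Definitions using (tri<; tri≈; tri>)
open import Relation.Binary.PropositionalEquality as ≡ using (_≡_; cong; cong₂)
import Relation.Binary.Reasoning.Setoid as SetoidReasoning
open import Relation.Nullary.Decidable using (dec-true; dec-false; yes; no)
open import Relation.Nullary.Negation.Core using (¬_; contradiction)

module MatrixSeriesProperties {c ℓ} (𝕂 : CommutativeRing c ℓ) where

  open CommutativeRing 𝕂
  open CommutativeSemigroupProperties +-commutativeSemigroup using (interchange)
  open MatrixSeries 𝕂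
  open RingProperties ring using (-‿distribʳ-*; -‿involutive; -0#≈0#)
  open SemiringSum semiring
  private module ≈ = SetoidReasoning setoid

  -- Finite sums of scalars.

  sum-zero : ∀ {n} {f : Fin n → Carrier} → (∀ i → f i ≈ 0#) → sum f ≈ 0#
  sum-zero {n} f≈0 = trans (sum-cong-≋ f≈0) (sum-replicate-zero n)

  sum-select : ∀ {n} (i : Fin n) (f : Fin n → Carrier) →
               ∑[ l < n ] (1ᴹ i l * f l) ≈ f i
  sum-select Fin.zero f = trans
    (+-cong (*-identityˡ _) (sum-zero λ l → zeroˡ (f (Fin.suc l))))
    (+-identityʳ _)
  sum-select (Fin.suc i) f = trans
    (+-cong (zeroˡ _) (sum-select i (λ l → f (Fin.suc l))))
    (+-identityˡ _)

  -- Matrices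

  *ᴹ-cong : ∀ {m k n} {A A′ : Matrix m k} {B B′ : Matrix k n} →
            A ≈ᴹ A′ → B ≈ᴹ B′ → A *ᴹ B ≈ᴹ A′ *ᴹ B′
  *ᴹ-cong {k = k} p q i j = sum-cong-≋ {k} λ l → *-cong (p i l) (q l j)

  *ᴹ-zeroˡ : ∀ {m k n} {A : Matrix m k} (B : Matrix k n) → A ≈ᴹ 0ᴹ → A *ᴹ B ≈ᴹ 0ᴹ
  *ᴹ-zeroˡ B p i j = sum-zero λ l → trans (*-congʳ (p i l)) (zeroˡ _)

  *ᴹ-zeroʳ : ∀ {m k n} (A : Matrix m k) {B : Matrix k n} → B ≈ᴹ 0ᴹ → A *ᴹ B ≈ᴹ 0ᴹ
  *ᴹ-zeroʳ A q i j = sum-zero λ l → trans (*-congˡ (q l j)) (zeroʳ _)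

  *ᴹ-distribˡ : ∀ {m k n} (A : Matrix m k) (B C : Matrix k n) →
                A *ᴹ (λ i j → B i j + C i j) ≈ᴹ λ i j → (A *ᴹ B) i j + (A *ᴹ C) i j
  *ᴹ-distribˡ {k = k} A B C i j =
    trans (sum-cong-≋ {k} λ l → distribˡ _ _ _) (∑-distrib-+ {k} _ _)

  *ᴹ-distribʳ : ∀ {m k n} (A B : Matrix m k) (C : Matrix k n) →
                (λ i j → A i j + B i j) *ᴹ C ≈ᴹ λ i j → (A *ᴹ C) i j + (B *ᴹ C) i j
  *ᴹ-distribʳ {k = k} A B C i j =
    trans (sum-cong-≋ {k} λ l → distribʳ _ _ _) (∑-distrib-+ {k} _ _)

  *ᴹ-distribˡ-sum : ∀ {m k n p} (A : Matrix m k) (B : Fin p → Matrix k n) →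
                    A *ᴹ (λ i j → ∑[ e < p ] B e i j) ≈ᴹ λ i j → ∑[ e < p ] (A *ᴹ B e) i j
  *ᴹ-distribˡ-sum {k = k} {p = p} A B i j = trans
    (sum-cong-≋ {k} λ l → *-distribˡ-sum (A i l) (λ e → B e l j))
    (∑-comm {k} {p} _)

  *ᴹ-assoc : ∀ {m k l n} (A : Matrix m k) (B : Matrix k l) (C : Matrix l n) →
             (A *ᴹ B) *ᴹ C ≈ᴹ A *ᴹ (B *ᴹ C)
  *ᴹ-assoc {k = k} {l} A B C i j = trans
    (sum-cong-≋ {l} λ l → trans
      (*-distribʳ-sum (C l j) (λ k → A i k * B k l))
      (sum-cong-≋ {k} λ k → *-assoc (A i k) (B k l) (C l j)))
    (trans (∑-comm {l} {k} _)
           (sum-cong-≋ {k} λ k → sym (*-distribˡ-sum (A i k) (λ l → B k l * C l j))))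

  *ᴹ-identityˡ : ∀ {m n} (A : Matrix m n) → 1ᴹ *ᴹ A ≈ᴹ A
  *ᴹ-identityˡ A i j = sum-select i (λ l → A l j)

  *ᴹ-transpose : ∀ {m k n} (A : Matrix m k) (B : Matrix k n) →
                 transpose (A *ᴹ B) ≈ᴹ transpose B *ᴹ transpose A
  *ᴹ-transpose A B i j = sum-cong-≋ λ l → *-comm (A j l) (B l i)

  1ᴹ-transpose : ∀ {n} → transpose (1ᴹ {n}) ≈ᴹ 1ᴹ
  1ᴹ-transpose Fin.zero    Fin.zero    = refl
  1ᴹ-transpose Fin.zero    (Fin.suc j) = refl
  1ᴹ-transpose (Fin.suc i) Fin.zero    = refl
  1ᴹ-transpose (Fin.suc i) (Fin.suc j) = 1ᴹ-transpose i j

  -- Series modulo powers of t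

  -- Congruence modulo t^E plays the role of equality here, so every group-theoretic cancellation
  -- law becomes available for truncated series.
  +ˢ-abelianGroup : ℕ → ℕ → ℕ → AbelianGroup c ℓ
  +ˢ-abelianGroup E m n = record
    { Carrier = Series m n
    ; _≈_ = _≈[ E ]_
    ; _∙_ = _+ˢ_
    ; ε = 0ˢ
    ; _⁻¹ = -ˢ_
    ; isAbelianGroup = record
      { isGroup = record
        { isMonoid = record
          { isSemigroup = record
            { isMagma = record
              { isEquivalence = record
                { refl  = λ d _ i j → refl
                ; sym   = λ p d d< i j → sym (p d d< i j)
                ; trans = λ p q d d< i j → trans (p d d< i j) (q d d< i j)
                }
              ; ∙-cong = λ p q d d< i j → +-cong (p d d< i j) (q d d< i j)
              }
            ; assoc = λ X Y Z d _ i j → +-assoc _ _ _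
            }
          ; identity = (λ X d _ i j → +-identityˡ _) , (λ X d _ i j → +-identityʳ _)
          }
        ; inverse = (λ X d _ i j → -‿inverseˡ _) , (λ X d _ i j → -‿inverseʳ _)
        ; ⁻¹-cong = λ p d d< i j → -‿cong (p d d< i j)
        }
      ; comm = λ X Y d _ i j → +-comm _ _
      }
    }

  +ˢ-interchange : ∀ {E m n} (W X Y Z : Series m n) →
                   (W +ˢ X) +ˢ (Y +ˢ Z) ≈[ E ] (W +ˢ Y) +ˢ (X +ˢ Z)
  +ˢ-interchange W X Y Z d _ i j = interchange _ _ _ _

  -- Additive reasoning at one fixed precision. The proof moves between the precisions D, E and D +
  -- E, and each calculation opens the instance that it works in.
  module Mod (E : ℕ) {m n : ℕ} where
    open AbelianGroup (+ˢ-abelianGroup E m n) public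
      using () renaming
      ( setoid to ≈-setoid; sym to ≈-sym; trans to ≈-trans
      ; ∙-cong to +ˢ-cong; ∙-congˡ to +ˢ-congˡ; ∙-congʳ to +ˢ-congʳ; ⁻¹-cong to -ˢ-cong
      ; assoc to +ˢ-assoc; comm to +ˢ-comm
      ; identityˡ to +ˢ-identityˡ; identityʳ to +ˢ-identityʳ
      ; inverseˡ to -ˢ-inverseˡ; inverseʳ to -ˢ-inverseʳ
      )
    open AbelianGroupProperties (+ˢ-abelianGroup E m n) public
      using (xyx⁻¹≈y; inverseʳ-unique; //-rightDividesˡ; ⁻¹-anti-homo‿-; x∙y⁻¹≈ε⇒x≈y; x≈y⇒x∙y⁻¹≈ε)
    open SetoidReasoning ≈-setoid public

    x+[y-x]≈y : ∀ X Y → X +ˢ (Y -ˢ X) ≈[ E ] Y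
    x+[y-x]≈y X Y = ≈-trans (≈-sym (+ˢ-assoc X Y (-ˢ X))) (xyx⁻¹≈y X Y)

    x-[x-y]≈y : ∀ X Y → X -ˢ (X -ˢ Y) ≈[ E ] Y
    x-[x-y]≈y X Y = ≈-trans (+ˢ-congˡ (⁻¹-anti-homo‿- X Y)) (x+[y-x]≈y X Y)

  ≈-mono : ∀ {D E m n} {X Y : Series m n} → E ℕ.≤ D → X ≈[ D ] Y → X ≈[ E ] Y
  ≈-mono E≤D p d d<E = p d (ℕ.<-≤-trans d<E E≤D)

  ᵀ-cong : ∀ {E m n} {X Y : Series m n} → X ≈[ E ] Y → X ᵀ ≈[ E ] Y ᵀ
  ᵀ-cong p d d< i j = p d d< j i

  -- The product of series: congruence, bilinearity, vanishing and transposition.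

  convolution : ∀ {m k n} → Series m k → Series k n →
                ∀ d → Fin m → Fin n → Fin (suc d) → Carrier
  convolution X Y d i j e = (X (toℕ e) *ᴹ Y (d ∸ toℕ e)) i j

  *ˢ-cong : ∀ {E m k n} {X X′ : Series m k} {Y Y′ : Series k n} →
            X ≈[ E ] X′ → Y ≈[ E ] Y′ → X *ˢ Y ≈[ E ] X′ *ˢ Y′
  *ˢ-cong p q d d<E i j = sum-cong-≋ {suc d} λ e → *ᴹ-cong
    (p (toℕ e) (ℕ.≤-<-trans (Fin.toℕ≤pred[n] e) d<E))
    (q (d ∸ toℕ e) (ℕ.≤-<-trans (ℕ.m∸n≤m d (toℕ e)) d<E)) i j

  *ˢ-congˡ : ∀ {E m k n} (X : Series m k) {Y Y′ : Series k n} →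
             Y ≈[ E ] Y′ → X *ˢ Y ≈[ E ] X *ˢ Y′
  *ˢ-congˡ X = *ˢ-cong {X = X} (λ _ _ _ _ → refl)

  *ˢ-congʳ : ∀ {E m k n} {X X′ : Series m k} (Y : Series k n) →
             X ≈[ E ] X′ → X *ˢ Y ≈[ E ] X′ *ˢ Y
  *ˢ-congʳ Y p = *ˢ-cong {Y = Y} p (λ _ _ _ _ → refl)

  *ˢ-distribˡ : ∀ {E m k n} (X : Series m k) (Y Z : Series k n) →
                X *ˢ (Y +ˢ Z) ≈[ E ] X *ˢ Y +ˢ X *ˢ Z
  *ˢ-distribˡ X Y Z d _ i j = trans
    (sum-cong-≋ {suc d} λ e → *ᴹ-distribˡ (X (toℕ e)) (Y (d ∸ toℕ e)) (Z (d ∸ toℕ e)) i j)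
    (∑-distrib-+ (convolution X Y d i j) (convolution X Z d i j))

  *ˢ-distribʳ : ∀ {E m k n} (X Y : Series m k) (Z : Series k n) →
                (X +ˢ Y) *ˢ Z ≈[ E ] X *ˢ Z +ˢ Y *ˢ Z
  *ˢ-distribʳ X Y Z d _ i j = trans
    (sum-cong-≋ {suc d} λ e → *ᴹ-distribʳ (X (toℕ e)) (Y (toℕ e)) (Z (d ∸ toℕ e)) i j)
    (∑-distrib-+ (convolution X Z d i j) (convolution Y Z d i j))

  -- Orders of vanishing add up: in a convolution term of total degree below p + q, either the left
  -- index is below p or the right index is below q. This removes the quadratic term of the lift and
  -- drives the construction of inverses.
  *ˢ-zero-+ : ∀ {p q m k n} {X : Series m k} {Y : Series k n} →
              X ≈[ p ] 0ˢ → Y ≈[ q ] 0ˢ → X *ˢ Y ≈[ p ℕ.+ q ] 0ˢ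
  *ˢ-zero-+ {p} {q} {X = X} {Y} X≈0 Y≈0 d d<p+q i j = sum-zero {suc d} term
    where
    term : ∀ e → (X (toℕ e) *ᴹ Y (d ∸ toℕ e)) i j ≈ 0#
    term e with toℕ e ℕ.<? p
    ... | yes e<p = *ᴹ-zeroˡ (Y (d ∸ toℕ e)) (X≈0 (toℕ e) e<p) i j
    ... | no  e≮p = *ᴹ-zeroʳ (X (toℕ e)) (Y≈0 (d ∸ toℕ e) d∸e<q) i j
      where
      d∸e<q : d ∸ toℕ e ℕ.< q
      d∸e<q = ℕ.≤-<-trans (ℕ.∸-monoʳ-≤ d (ℕ.≮⇒≥ e≮p)) (ℕ.+-cancelˡ-< p _ _
        (≡.subst (ℕ._< p ℕ.+ q) (≡.sym (ℕ.m+[n∸m]≡n p≤d)) d<p+q))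
        where
        p≤d : p ℕ.≤ d
        p≤d = ℕ.≤-trans (ℕ.≮⇒≥ e≮p) (Fin.toℕ≤pred[n] e)

  *ˢ-zeroˡ : ∀ {E m k n} (Y : Series k n) → 0ˢ {m} *ˢ Y ≈[ E ] 0ˢ
  -- With q = 0 the assumption on `Y` is vacuous, and the zero factor supplies all of the order E.
  *ˢ-zeroˡ {E} Y = ≈-mono (ℕ.m≤m+n E 0) (*ˢ-zero-+ {E} {0} {Y = Y} (λ _ _ _ _ → refl) (λ _ ()))

  *ˢ-zeroʳ : ∀ {E m k n} (X : Series m k) → X *ˢ 0ˢ {k} {n} ≈[ E ] 0ˢ
  *ˢ-zeroʳ X = *ˢ-zero-+ {0} {X = X} (λ _ ()) (λ _ _ _ _ → refl)

  *ˢ--ʳ : ∀ {E m k n} (X : Series m k) (Y : Series k n) → X *ˢ (-ˢ Y) ≈[ E ] -ˢ (X *ˢ Y)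
  *ˢ--ʳ {E} X Y = inverseʳ-unique (X *ˢ Y) (X *ˢ (-ˢ Y)) (begin
    X *ˢ Y +ˢ X *ˢ (-ˢ Y)  ≈⟨ *ˢ-distribˡ X Y (-ˢ Y) ⟨
    X *ˢ (Y -ˢ Y)          ≈⟨ *ˢ-congˡ X (-ˢ-inverseʳ Y) ⟩
    X *ˢ 0ˢ                ≈⟨ *ˢ-zeroʳ X ⟩
    0ˢ                     ∎)
    where open Mod E

  *ˢ--ˡ : ∀ {E m k n} (X : Series m k) (Y : Series k n) → (-ˢ X) *ˢ Y ≈[ E ] -ˢ (X *ˢ Y)
  *ˢ--ˡ {E} X Y = inverseʳ-unique (X *ˢ Y) ((-ˢ X) *ˢ Y) (begin
    X *ˢ Y +ˢ (-ˢ X) *ˢ Y  ≈⟨ *ˢ-distribʳ X (-ˢ X) Y ⟨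
    (X -ˢ X) *ˢ Y          ≈⟨ *ˢ-congʳ Y (-ˢ-inverseʳ X) ⟩
    0ˢ *ˢ Y                ≈⟨ *ˢ-zeroˡ Y ⟩
    0ˢ                     ∎)
    where open Mod E

  *ˢ-distribˡ-- : ∀ {E m k n} (X : Series m k) (Y Z : Series k n) →
                  X *ˢ (Y -ˢ Z) ≈[ E ] X *ˢ Y -ˢ X *ˢ Z
  *ˢ-distribˡ-- {E} X Y Z = ≈-trans (*ˢ-distribˡ X Y (-ˢ Z)) (+ˢ-congˡ (*ˢ--ʳ X Z))
    where open Mod E

  *ˢ-distribʳ-- : ∀ {E m k n} (X Y : Series m k) (Z : Series k n) →
                  (X -ˢ Y) *ˢ Z ≈[ E ] X *ˢ Z -ˢ Y *ˢ Z
  *ˢ-distribʳ-- {E} X Y Z = ≈-trans (*ˢ-distribʳ X (-ˢ Y) Z) (+ˢ-congˡ (*ˢ--ˡ Y Z))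
    where open Mod E

  -- Reversing the order of summation exchanges the two convolution indices, and commutativity of
  -- the scalars exchanges the factors in each entry. Right-handed laws are later obtained from
  -- left-handed ones through this identity.
  *ˢ-ᵀ : ∀ {E m k n} (X : Series m k) (Y : Series k n) →
         (X *ˢ Y) ᵀ ≈[ E ] Y ᵀ *ˢ X ᵀ
  *ˢ-ᵀ X Y d _ i j = trans
    (sum-permute (convolution X Y d j i) Permutation.reverse)
    (sum-cong-≋ {suc d} λ e → trans
      (reflexive (cong₂ (λ a b → (X a *ᴹ Y b) j i) (Fin.opposite-prop e) (reverse e)))
      (*ᴹ-transpose (X (d ∸ toℕ e)) (Y (toℕ e)) i j))
    where
    reverse : (e : Fin (suc d)) → d ∸ toℕ (opposite e) ≡ toℕ e
    reverse e = ≡.trans (cong (d ∸_) (Fin.opposite-prop e)) (ℕ.m∸[m∸n]≡n (Fin.toℕ≤pred[n] e))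

  tailˢ : ∀ {m n} → Series m n → Series m n
  tailˢ X d = X (suc d)

  -- The convolution satisfies X Y = X₀ Y + t (tailˢ X) Y, which holds by
  -- computation on coefficients and drives the inductions on the degree.

  *ᴹ-*ˢ-assoc : ∀ {m k l n} (A : Matrix m k) (Y : Series k l) (Z : Series l n) d →
                ((λ e → A *ᴹ Y e) *ˢ Z) d ≈ᴹ A *ᴹ (Y *ˢ Z) d
  *ᴹ-*ˢ-assoc A Y Z d i j = trans
    (sum-cong-≋ {suc d} λ e → *ᴹ-assoc A (Y (toℕ e)) (Z (d ∸ toℕ e)) i j)
    (sym (*ᴹ-distribˡ-sum {p = suc d} A (λ e → Y (toℕ e) *ᴹ Z (d ∸ toℕ e)) i j))

  -- Induction on the degree for all `X` at once, since the hypothesis is applied to `tailˢ X`. The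
  -- tail of X Y splits as X₀ (`tailˢ Y`) + (`tailˢ X`) Y; the first part is handled by
  -- associativity with a constant matrix, the second by induction.
  *ˢ-assoc-coeff : ∀ {m k l n} (X : Series m k) (Y : Series k l) (Z : Series l n) d →
                   (X *ˢ Y *ˢ Z) d ≈ᴹ (X *ˢ (Y *ˢ Z)) d
  *ˢ-assoc-coeff X Y Z zero i j = +-congʳ (trans
    (*ᴹ-cong {A′ = X 0 *ᴹ Y 0} {B = Z 0} (λ i l → +-identityʳ _) (λ _ _ → refl) i j)
    (trans (*ᴹ-assoc (X 0) (Y 0) (Z 0) i j)
           (*ᴹ-cong {A = X 0} {B = Y 0 *ᴹ Z 0} (λ _ _ → refl) (λ i l → sym (+-identityʳ _)) i j)))
  *ˢ-assoc-coeff X Y Z (suc d) i j = begin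
    ((X *ˢ Y) 0 *ᴹ Z (suc d)) i j + (tailˢ (X *ˢ Y) *ˢ Z) d i j
      ≈⟨ +-cong (*ᴹ-cong {A′ = X 0 *ᴹ Y 0} {B = Z (suc d)} (λ i l → +-identityʳ _) (λ _ _ → refl) i j)
                (*ˢ-distribʳ (λ e → X 0 *ᴹ Y (suc e)) (tailˢ X *ˢ Y) Z d (ℕ.n<1+n d) i j) ⟩
    ((X 0 *ᴹ Y 0) *ᴹ Z (suc d)) i j
      + (((λ e → X 0 *ᴹ Y (suc e)) *ˢ Z) d i j + (tailˢ X *ˢ Y *ˢ Z) d i j)
      ≈⟨ +-cong (*ᴹ-assoc (X 0) (Y 0) (Z (suc d)) i j)
                (+-cong (*ᴹ-*ˢ-assoc (X 0) (tailˢ Y) Z d i j)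
                        (*ˢ-assoc-coeff (tailˢ X) Y Z d i j)) ⟩
    (X 0 *ᴹ (Y 0 *ᴹ Z (suc d))) i j
      + ((X 0 *ᴹ (tailˢ Y *ˢ Z) d) i j + (tailˢ X *ˢ (Y *ˢ Z)) d i j)
      ≈⟨ +-assoc _ _ _ ⟨
    (X 0 *ᴹ (Y 0 *ᴹ Z (suc d))) i j + (X 0 *ᴹ (tailˢ Y *ˢ Z) d) i j
      + (tailˢ X *ˢ (Y *ˢ Z)) d i j
      ≈⟨ +-congʳ (*ᴹ-distribˡ (X 0) (Y 0 *ᴹ Z (suc d)) ((tailˢ Y *ˢ Z) d) i j) ⟨
    (X *ˢ (Y *ˢ Z)) (suc d) i j ∎
    where open ≈

  *ˢ-assoc : ∀ {E m k l n} (X : Series m k) (Y : Series k l) (Z : Series l n) →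
             X *ˢ Y *ˢ Z ≈[ E ] X *ˢ (Y *ˢ Z)
  *ˢ-assoc X Y Z d _ = *ˢ-assoc-coeff X Y Z d

  *ˢ-identityˡ : ∀ {E m n} (X : Series m n) → 1ˢ *ˢ X ≈[ E ] X
  *ˢ-identityˡ X zero    _ i j = trans (+-identityʳ _) (*ᴹ-identityˡ (X 0) i j)
  *ˢ-identityˡ X (suc d) _ i j = trans
    (+-cong (*ᴹ-identityˡ (X (suc d)) i j) (*ˢ-zeroˡ X d (ℕ.n<1+n d) i j))
    (+-identityʳ _)

  1ˢ-ᵀ : ∀ {E n} → 1ˢ {n} ᵀ ≈[ E ] 1ˢ
  1ˢ-ᵀ zero    _ = 1ᴹ-transpose
  1ˢ-ᵀ (suc d) _ i j = refl

  *ˢ-identityʳ : ∀ {E m n} (X : Series m n) → X *ˢ 1ˢ ≈[ E ] X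
  -- Transposing twice gives back the same series, so it suffices to prove the transposed claim,
  -- where the left identity applies.
  *ˢ-identityʳ {E} X = ᵀ-cong (begin
    (X *ˢ 1ˢ) ᵀ    ≈⟨ *ˢ-ᵀ X 1ˢ ⟩
    1ˢ ᵀ *ˢ X ᵀ    ≈⟨ *ˢ-congʳ (X ᵀ) 1ˢ-ᵀ ⟩
    1ˢ *ˢ X ᵀ      ≈⟨ *ˢ-identityˡ (X ᵀ) ⟩
    X ᵀ            ∎)
    where open Mod E

  -- Multiplication by powers of t

  ·t^-< : ∀ D {m n} (X : Series m n) → X ·t^ D ≈[ D ] 0ˢ
  ·t^-< D X d d<D i j with D ℕ.≤? d
  ... | yes D≤d = contradiction D≤d (ℕ.<⇒≱ d<D)
  ... | no  _   = refl

  ·t^-+ : ∀ {m n} (X : Series m n) D d → (X ·t^ D) (D ℕ.+ d) ≈ᴹ X d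
  ·t^-+ X D d i j with D ℕ.≤? D ℕ.+ d
  ... | yes _   = reflexive (cong (λ e → X e i j) (ℕ.m+n∸m≡n D d))
  ... | no  D≰d = contradiction (ℕ.m≤m+n D d) D≰d

  ·t^-suc : ∀ {m n} (X : Series m n) D d → (X ·t^ suc D) (suc d) ≈ᴹ (X ·t^ D) d
  ·t^-suc X D d i j with suc D ℕ.≤? suc d | D ℕ.≤? d
  ... | yes _   | yes _   = refl
  ... | yes D≤d | no D≰d  = contradiction (ℕ.s≤s⁻¹ D≤d) D≰d
  ... | no D≰d  | yes D≤d = contradiction (ℕ.s≤s D≤d) D≰d
  ... | no _    | no _    = refl

  0ˢ-·t^ : ∀ D {E m n} → 0ˢ {m} {n} ·t^ D ≈[ E ] 0ˢ
  0ˢ-·t^ D d _ i j with D ℕ.≤? d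
  ... | yes _ = refl
  ... | no  _ = refl

  ·t^-cong : ∀ D {E m n} {X Y : Series m n} → X ≈[ E ] Y → X ·t^ D ≈[ D ℕ.+ E ] Y ·t^ D
  ·t^-cong D {E} p d d<D+E i j with D ℕ.≤? d
  ... | no  _   = refl
  ... | yes D≤d = p (d ∸ D)
    (ℕ.+-cancelˡ-< D _ _ (≡.subst (ℕ._< D ℕ.+ E) (≡.sym (ℕ.m+[n∸m]≡n D≤d)) d<D+E)) i j

  -- The coefficient of degree d is read off from degree D + d of the shifted series, so D + E known
  -- degrees leave E after cancellation.
  ·t^-cancel : ∀ D {E m n} {X Y : Series m n} → X ·t^ D ≈[ D ℕ.+ E ] Y ·t^ D → X ≈[ E ] Y
  ·t^-cancel D {X = X} {Y} p d d<E i j = trans (sym (·t^-+ X D d i j))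
    (trans (p (D ℕ.+ d) (ℕ.+-monoʳ-< D d<E) i j) (·t^-+ Y D d i j))

  ·t^-distrib-+ : ∀ D {E m n} (X Y : Series m n) →
                  (X +ˢ Y) ·t^ D ≈[ E ] X ·t^ D +ˢ Y ·t^ D
  ·t^-distrib-+ D X Y d _ i j with D ℕ.≤? d
  ... | yes _ = refl
  ... | no  _ = sym (+-identityˡ 0#)

  ·t^-ᵀ : ∀ D {E m n} (X : Series m n) → (X ·t^ D) ᵀ ≈[ E ] X ᵀ ·t^ D
  ·t^-ᵀ D X d _ i j with D ℕ.≤? d
  ... | yes _ = refl
  ... | no  _ = refl

  -- Induction on D: a series shifted by `suc D` has zero constant term, and its tail is the series
  -- shifted by D.
  ·t^-*ˢ-coeff : ∀ {m k n} (X : Series m k) (Y : Series k n) D d →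
                 (X ·t^ D *ˢ Y) d ≈ᴹ ((X *ˢ Y) ·t^ D) d
  ·t^-*ˢ-coeff X Y zero d i j = trans
    (*ˢ-congʳ Y (λ d _ → ·t^-+ X 0 d) d (ℕ.n<1+n d) i j)
    (sym (·t^-+ (X *ˢ Y) 0 d i j))
  ·t^-*ˢ-coeff X Y (suc D) zero i j = begin
    (X ·t^ suc D *ˢ Y) 0 i j
      ≈⟨ +-identityʳ _ ⟩
    ((X ·t^ suc D) 0 *ᴹ Y 0) i j
      ≈⟨ *ᴹ-zeroˡ (Y 0) (·t^-< (suc D) X 0 z<s) i j ⟩
    0#
      ≈⟨ ·t^-< (suc D) (X *ˢ Y) 0 z<s i j ⟨
    ((X *ˢ Y) ·t^ suc D) 0 i j ∎
    where open ≈
  ·t^-*ˢ-coeff X Y (suc D) (suc d) i j = begin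
    ((X ·t^ suc D) 0 *ᴹ Y (suc d)) i j + (tailˢ (X ·t^ suc D) *ˢ Y) d i j
      ≈⟨ +-cong (*ᴹ-zeroˡ (Y (suc d)) (·t^-< (suc D) X 0 z<s) i j)
                (*ˢ-congʳ Y (λ d _ → ·t^-suc X D d) d (ℕ.n<1+n d) i j) ⟩
    0# + (X ·t^ D *ˢ Y) d i j
      ≈⟨ +-identityˡ _ ⟩
    (X ·t^ D *ˢ Y) d i j
      ≈⟨ ·t^-*ˢ-coeff X Y D d i j ⟩
    ((X *ˢ Y) ·t^ D) d i j
      ≈⟨ ·t^-suc (X *ˢ Y) D d i j ⟨
    ((X *ˢ Y) ·t^ suc D) (suc d) i j ∎
    where open ≈

  ·t^-*ˢ : ∀ D {E m k n} (X : Series m k) (Y : Series k n) →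
           X ·t^ D *ˢ Y ≈[ E ] (X *ˢ Y) ·t^ D
  ·t^-*ˢ D X Y d _ = ·t^-*ˢ-coeff X Y D d

  *ˢ-·t^ : ∀ D {E m k n} (X : Series m k) (Y : Series k n) →
           X *ˢ Y ·t^ D ≈[ E ] (X *ˢ Y) ·t^ D
  *ˢ-·t^ D {E} X Y = ᵀ-cong (begin
    (X *ˢ Y ·t^ D) ᵀ      ≈⟨ *ˢ-ᵀ X (Y ·t^ D) ⟩
    (Y ·t^ D) ᵀ *ˢ X ᵀ    ≈⟨ *ˢ-congʳ (X ᵀ) (·t^-ᵀ D Y) ⟩
    Y ᵀ ·t^ D *ˢ X ᵀ      ≈⟨ ·t^-*ˢ D (Y ᵀ) (X ᵀ) ⟩
    (Y ᵀ *ˢ X ᵀ) ·t^ D    ≈⟨ ≈-mono (ℕ.m≤n+m E D) (·t^-cong D (*ˢ-ᵀ X Y)) ⟨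
    ((X *ˢ Y) ᵀ) ·t^ D    ≈⟨ ·t^-ᵀ D (X *ˢ Y) ⟨
    (((X *ˢ Y) ·t^ D) ᵀ)  ∎)
    where open Mod E

  lift-*ˢ : ∀ {D E m k n} → E ℕ.≤ D → (X X′ : Series m k) (Y Y′ : Series k n) →
            (X +ˢ X′ ·t^ D) *ˢ (Y +ˢ Y′ ·t^ D)
              ≈[ D ℕ.+ E ] X *ˢ Y +ˢ (X′ *ˢ Y +ˢ X *ˢ Y′) ·t^ D
  lift-*ˢ {D} {E} E≤D X X′ Y Y′ = begin
    (X +ˢ X′ ·t^ D) *ˢ (Y +ˢ Y′ ·t^ D)
      ≈⟨ *ˢ-distribʳ X (X′ ·t^ D) _ ⟩
    X *ˢ (Y +ˢ Y′ ·t^ D) +ˢ X′ ·t^ D *ˢ (Y +ˢ Y′ ·t^ D)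
      ≈⟨ +ˢ-cong (*ˢ-distribˡ X Y _) (*ˢ-distribˡ (X′ ·t^ D) Y _) ⟩
    X *ˢ Y +ˢ X *ˢ Y′ ·t^ D +ˢ (X′ ·t^ D *ˢ Y +ˢ X′ ·t^ D *ˢ Y′ ·t^ D)
      ≈⟨ +ˢ-cong (+ˢ-congˡ (*ˢ-·t^ D X Y′)) (+ˢ-cong (·t^-*ˢ D X′ Y) quadratic≈0) ⟩
    X *ˢ Y +ˢ (X *ˢ Y′) ·t^ D +ˢ ((X′ *ˢ Y) ·t^ D +ˢ 0ˢ)
      ≈⟨ +ˢ-congˡ (+ˢ-identityʳ ((X′ *ˢ Y) ·t^ D)) ⟩
    X *ˢ Y +ˢ (X *ˢ Y′) ·t^ D +ˢ (X′ *ˢ Y) ·t^ D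
      ≈⟨ +ˢ-assoc (X *ˢ Y) ((X *ˢ Y′) ·t^ D) ((X′ *ˢ Y) ·t^ D) ⟩
    X *ˢ Y +ˢ ((X *ˢ Y′) ·t^ D +ˢ (X′ *ˢ Y) ·t^ D)
      ≈⟨ +ˢ-congˡ (+ˢ-comm ((X *ˢ Y′) ·t^ D) ((X′ *ˢ Y) ·t^ D)) ⟩
    X *ˢ Y +ˢ ((X′ *ˢ Y) ·t^ D +ˢ (X *ˢ Y′) ·t^ D)
      ≈⟨ +ˢ-congˡ (·t^-distrib-+ D (X′ *ˢ Y) (X *ˢ Y′)) ⟨
    X *ˢ Y +ˢ (X′ *ˢ Y +ˢ X *ˢ Y′) ·t^ D ∎
    where
    open Mod (D ℕ.+ E)
    quadratic≈0 : X′ ·t^ D *ˢ Y′ ·t^ D ≈[ D ℕ.+ E ] 0ˢ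
    -- Both factors have order at least D, so the product has order 2D, which is at least D + E.
    quadratic≈0 = ≈-mono (ℕ.+-monoʳ-≤ D E≤D) (*ˢ-zero-+ {D} {D} (·t^-< D X′) (·t^-< D Y′))

  -- Inverses modulo powers of t

  constant : ∀ {m n} → Matrix m n → Series m n
  constant A zero    = A
  constant A (suc _) = 0ᴹ

  -- If Y X = 1 - W with W ≡ 0 mod tᴱ and C X ≡ 1 mod t, then
  -- (Y + W C) X = 1 - W (1 - C X) ≡ 1 mod tᴱ⁺¹.
  left-inverse : ∀ {n} (X : Series n n) (B : Matrix n n) → B *ᴹ X 0 ≈ᴹ 1ᴹ →
                 ∀ E → ∃[ Y ] Y *ˢ X ≈[ E ] 1ˢ
  left-inverse X B BX₀≈1 zero    = 0ˢ , λ _ ()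
  left-inverse X B BX₀≈1 (suc E) with left-inverse X B BX₀≈1 E
  ... | Y , YX≈1 = Y +ˢ W *ˢ C , (begin
    (Y +ˢ W *ˢ C) *ˢ X       ≈⟨ *ˢ-distribʳ Y (W *ˢ C) X ⟩
    Y *ˢ X +ˢ W *ˢ C *ˢ X    ≈⟨ +ˢ-congˡ (*ˢ-assoc W C X) ⟩
    Y *ˢ X +ˢ W *ˢ (C *ˢ X)  ≈⟨ +ˢ-congˡ W≈WCX ⟨
    Y *ˢ X +ˢ W              ≈⟨ x+[y-x]≈y (Y *ˢ X) 1ˢ ⟩
    1ˢ                       ∎)
    where
    open Mod (suc E)
    C = constant B
    W = 1ˢ -ˢ Y *ˢ X

    W≈0 : W ≈[ E ] 0ˢ
    W≈0 = Mod.x≈y⇒x∙y⁻¹≈ε E (Mod.≈-sym E YX≈1)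

    CX≈1 : C *ˢ X ≈[ 1 ] 1ˢ
    CX≈1 zero _ i j = trans (+-identityʳ _) (BX₀≈1 i j)
    CX≈1 (suc d) (ℕ.s<s ())

    W[1-CX]≈0 : W *ˢ (1ˢ -ˢ C *ˢ X) ≈[ suc E ] 0ˢ
    W[1-CX]≈0 = ≈-mono (ℕ.≤-reflexive (ℕ.+-comm 1 E))
      (*ˢ-zero-+ W≈0 (Mod.x≈y⇒x∙y⁻¹≈ε 1 (Mod.≈-sym 1 CX≈1)))

    W≈WCX : W ≈[ suc E ] W *ˢ (C *ˢ X)
    W≈WCX = x∙y⁻¹≈ε⇒x≈y W (W *ˢ (C *ˢ X)) (begin
      W -ˢ W *ˢ (C *ˢ X)        ≈⟨ +ˢ-congʳ (*ˢ-identityʳ W) ⟨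
      W *ˢ 1ˢ -ˢ W *ˢ (C *ˢ X)  ≈⟨ *ˢ-distribˡ-- W 1ˢ (C *ˢ X) ⟨
      W *ˢ (1ˢ -ˢ C *ˢ X)       ≈⟨ W[1-CX]≈0 ⟩
      0ˢ                        ∎)

  -- A left inverse of the transpose, transposed back, is a right inverse `Z`. The left inverse `Y`
  -- then agrees with it, because Y = Y (X Z) = (Y X) Z = Z.
  inverse : ∀ {n} (X : Series n n) → Invertible (X 0) →
            ∀ E → ∃[ Y ] (X *ˢ Y ≈[ E ] 1ˢ × Y *ˢ X ≈[ E ] 1ˢ)
  inverse X (B , X₀B≈1 , BX₀≈1) E
    with left-inverse X B BX₀≈1 E | left-inverse (X ᵀ) (transpose B) BᵀX₀ᵀ≈1 E
    where
    BᵀX₀ᵀ≈1 : transpose B *ᴹ transpose (X 0) ≈ᴹ 1ᴹ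
    BᵀX₀ᵀ≈1 i j = trans (sym (*ᴹ-transpose (X 0) B i j))
                        (trans (X₀B≈1 j i) (1ᴹ-transpose i j))
  ... | Y , YX≈1 | Zᵀ , ZᵀXᵀ≈1 = Y , XY≈1 , YX≈1
    where
    open Mod E
    Z = Zᵀ ᵀ

    XZ≈1 : X *ˢ Z ≈[ E ] 1ˢ
    XZ≈1 = ᵀ-cong (begin
      (X *ˢ Z) ᵀ  ≈⟨ *ˢ-ᵀ X Z ⟩
      Zᵀ *ˢ X ᵀ   ≈⟨ ZᵀXᵀ≈1 ⟩
      1ˢ          ≈⟨ 1ˢ-ᵀ ⟨
      1ˢ ᵀ        ∎)

    Y≈Z : Y ≈[ E ] Z
    Y≈Z = begin
      Y              ≈⟨ *ˢ-identityʳ Y ⟨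
      Y *ˢ 1ˢ        ≈⟨ *ˢ-congˡ Y XZ≈1 ⟨
      Y *ˢ (X *ˢ Z)  ≈⟨ *ˢ-assoc Y X Z ⟨
      Y *ˢ X *ˢ Z    ≈⟨ *ˢ-congʳ Z YX≈1 ⟩
      1ˢ *ˢ Z        ≈⟨ *ˢ-identityˡ Z ⟩
      Z              ∎

    XY≈1 : X *ˢ Y ≈[ E ] 1ˢ
    XY≈1 = ≈-trans (*ˢ-congˡ X Y≈Z) XZ≈1

  Invertible-cong : ∀ {n} {A A′ : Matrix n n} → A ≈ᴹ A′ → Invertible A → Invertible A′
  Invertible-cong A≈A′ (B , AB≈1 , BA≈1) = B
    , (λ i j → trans (*ᴹ-cong {B = B} (λ i l → sym (A≈A′ i l)) (λ _ _ → refl) i j) (AB≈1 i j))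
    , (λ i j → trans (*ᴹ-cong {A = B} (λ _ _ → refl) (λ l j → sym (A≈A′ l j)) i j) (BA≈1 i j))

  -- Triangular series

  ∘ˢ-cong : ∀ {E m n} (P : Matrix m n) {X Y : Series m n} → X ≈[ E ] Y → P ∘ˢ X ≈[ E ] P ∘ˢ Y
  ∘ˢ-cong P p d d< i j = *-congˡ (p d d< i j)

  ∘ˢ-distrib-+ : ∀ {E m n} (P : Matrix m n) (X Y : Series m n) →
                 P ∘ˢ (X +ˢ Y) ≈[ E ] P ∘ˢ X +ˢ P ∘ˢ Y
  ∘ˢ-distrib-+ P X Y d _ i j = distribˡ _ _ _

  ∘ˢ-distrib-- : ∀ {E m n} (P : Matrix m n) (X Y : Series m n) →
                 P ∘ˢ (X -ˢ Y) ≈[ E ] P ∘ˢ X -ˢ P ∘ˢ Y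
  ∘ˢ-distrib-- P X Y d _ i j = trans (distribˡ _ _ _) (+-congˡ (sym (-‿distribʳ-* _ _)))

  ∘ˢ-·t^ : ∀ D {E m n} (P : Matrix m n) (X : Series m n) →
           P ∘ˢ (X ·t^ D) ≈[ E ] (P ∘ˢ X) ·t^ D
  ∘ˢ-·t^ D P X d _ i j with D ℕ.≤? d
  ... | yes _ = refl
  ... | no  _ = zeroʳ _

  P-L-< : ∀ {n} {i j : Fin n} → j Fin.< i → P-L i j ≡ 1#
  P-L-< {i = i} {j} j<i = cong (if_then 1# else 0#) (dec-true (j Fin.<? i) j<i)

  P-L-≮ : ∀ {n} {i j : Fin n} → ¬ j Fin.< i → P-L i j ≡ 0#
  P-L-≮ {i = i} {j} j≮i = cong (if_then 1# else 0#) (dec-false (j Fin.<? i) j≮i)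

  P-L-∘-cong : ∀ {n} {A B : Matrix n n} → (∀ {i j} → j Fin.< i → A i j ≈ B i j) →
               P-L ∘ᴹ A ≈ᴹ P-L ∘ᴹ B
  P-L-∘-cong p i j with j Fin.<? i
  ... | yes j<i = *-congˡ (p j<i)
  ... | no  j≮i rewrite P-L-≮ {i = i} {j} j≮i = trans (zeroˡ _) (sym (zeroˡ _))

  P-L-∘-below : ∀ {n} {A : Matrix n n} → P-L ∘ᴹ A ≈ᴹ 0ᴹ → ∀ {i j} → j Fin.< i → A i j ≈ 0#
  P-L-∘-below p {i} {j} j<i =
    trans (sym (*-identityˡ _)) (trans (*-congʳ (reflexive (≡.sym (P-L-< j<i)))) (p i j))

  P-L-∘-zero : ∀ {n} {A : Matrix n n} → (∀ {i j} → j Fin.< i → A i j ≈ 0#) → P-L ∘ᴹ A ≈ᴹ 0ᴹ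
  P-L-∘-zero {A = A} p i j = trans (P-L-∘-cong {A = A} {0ᴹ} p i j) (zeroʳ _)

  -- For j < i every index l satisfies l < i or j < l. In the first case the entry of `A` vanishes,
  -- in the second that of `B`.
  upper-triangular-*ᴹ : ∀ {n} {A B : Matrix n n} →
    P-L ∘ᴹ A ≈ᴹ 0ᴹ → P-L ∘ᴹ B ≈ᴹ 0ᴹ → ∀ {i j} → j Fin.< i → (A *ᴹ B) i j ≈ 0#
  upper-triangular-*ᴹ {A = A} {B} pA pB {i} {j} j<i = sum-zero term
    where
    term : ∀ l → A i l * B l j ≈ 0#
    term l with l Fin.<? i
    ... | yes l<i = trans (*-congʳ (P-L-∘-below pA l<i)) (zeroˡ _)
    ... | no  l≮i = trans (*-congˡ (P-L-∘-below pB (ℕ.<-≤-trans j<i (ℕ.≮⇒≥ l≮i)))) (zeroʳ _)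

  upper-triangular-*ˢ : ∀ {E n} {X Y : Series n n} →
    P-L ∘ˢ X ≈[ E ] 0ˢ → P-L ∘ˢ Y ≈[ E ] 0ˢ → P-L ∘ˢ (X *ˢ Y) ≈[ E ] 0ˢ
  upper-triangular-*ˢ {X = X} {Y} pX pY d d<E = P-L-∘-zero {A = (X *ˢ Y) d} λ j<i →
    sum-zero {suc d} λ e → upper-triangular-*ᴹ {A = X (toℕ e)} {Y (d ∸ toℕ e)}
      (pX (toℕ e) (ℕ.≤-<-trans (Fin.toℕ≤pred[n] e) d<E))
      (pY (d ∸ toℕ e) (ℕ.≤-<-trans (ℕ.m∸n≤m d (toℕ e)) d<E)) j<i

  -- The antisymmetric matrix with the strictly lower part of `A`: this part is reflected with a
  -- change of sign, and the diagonal is zero.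
  antisymmetrize : ∀ {n} → Matrix n n → Matrix n n
  antisymmetrize A i j with Fin.<-cmp i j
  ... | tri< _ _ _ = - A j i
  ... | tri≈ _ _ _ = 0#
  ... | tri> _ _ _ = A i j

  antisymmetrize-transpose : ∀ {n} (A : Matrix n n) i j →
                             antisymmetrize A j i ≈ - antisymmetrize A i j
  antisymmetrize-transpose A i j with Fin.<-cmp i j | Fin.<-cmp j i
  ... | tri< _ _ _   | tri> _ _ _   = sym (-‿involutive _)
  ... | tri≈ _ _ _   | tri≈ _ _ _   = sym -0#≈0#
  ... | tri> _ _ _   | tri< _ _ _   = refl
  -- The two comparisons are decided independently; the remaining six outcomes are inconsistent.
  ... | tri< i<j _ _ | tri< _ _ i≮j = contradiction i<j i≮j
  ... | tri< _ i≢j _ | tri≈ _ j≡i _ = contradiction (≡.sym j≡i) i≢j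
  ... | tri≈ _ i≡j _ | tri< _ j≢i _ = contradiction (≡.sym i≡j) j≢i
  ... | tri≈ _ i≡j _ | tri> _ j≢i _ = contradiction (≡.sym i≡j) j≢i
  ... | tri> _ i≢j _ | tri≈ _ j≡i _ = contradiction (≡.sym j≡i) i≢j
  ... | tri> i≮j _ _ | tri> _ _ i<j = contradiction i<j i≮j

  antisymmetrize-below : ∀ {n} (A : Matrix n n) → P-L ∘ᴹ antisymmetrize A ≈ᴹ P-L ∘ᴹ A
  antisymmetrize-below A = P-L-∘-cong below
    where
    below : ∀ {i j} → j Fin.< i → antisymmetrize A i j ≈ A i j
    below {i} {j} j<i with Fin.<-cmp i j
    ... | tri< _ _ j≮i = contradiction j<i j≮i
    ... | tri≈ _ _ j≮i = contradiction j<i j≮i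
    ... | tri> _ _ _   = refl

  -- Matrix polynomials

  coefficients : ∀ E {m n} → Series m n → MatPoly E m n
  coefficients E X e = X (toℕ e)

  ⟦⟧-< : ∀ {D d m n} (X : MatPoly D m n) (d<D : d ℕ.< D) → ⟦ X ⟧ d ≡ X (fromℕ< d<D)
  ⟦⟧-< {D} {d} X d<D with d ℕ.<? D
  ... | yes _   = ≡.refl
  ... | no  d≮D = contradiction d<D d≮D

  ⟦coefficients⟧ : ∀ {E m n} (X : Series m n) → ⟦ coefficients E X ⟧ ≈[ E ] X
  ⟦coefficients⟧ {E} X d d<E i j = reflexive (cong (λ A → A i j)
    (≡.trans (⟦⟧-< (coefficients E X) d<E) (cong X (Fin.toℕ-fromℕ< d<E))))

  ⟦truncate⟧ : ∀ {D E m n} (E≤D : E ℕ.≤ D) (X : MatPoly D m n) →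
               ⟦ truncate E≤D X ⟧ ≈[ E ] ⟦ X ⟧
  ⟦truncate⟧ E≤D X d d<E i j = reflexive (cong (λ A → A i j)
    (≡.trans (⟦⟧-< (truncate E≤D X) d<E)
    (≡.trans (cong X (Fin.toℕ-injective index)) (≡.sym (⟦⟧-< X d<D)))))
    where
    d<D = ℕ.<-≤-trans d<E E≤D
    index : toℕ (inject≤ (fromℕ< d<E) E≤D) ≡ toℕ (fromℕ< d<D)
    index = ≡.trans (Fin.toℕ-inject≤ (fromℕ< d<E) E≤D)
      (≡.trans (Fin.toℕ-fromℕ< d<E) (≡.sym (Fin.toℕ-fromℕ< d<D)))

  -- A polynomial has zero coefficients from degree D on, so triangularity modulo t^D holds to every
  -- precision. This is what carries the assumption on R from D to D + E.
  upper-triangular-⟦⟧ : ∀ {D n} (X : MatPoly D n n) → P-L ∘ˢ ⟦ X ⟧ ≈[ D ] 0ˢ →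
                        ∀ {E} → P-L ∘ˢ ⟦ X ⟧ ≈[ E ] 0ˢ
  upper-triangular-⟦⟧ {D} X p d _ with d ℕ.<? D | p d
  ... | yes d<D | q = q d<D
  ... | no  _   | _ = λ i j → zeroʳ _

  -- Division by t^D, exact when the series vanishes modulo t^D; `ΔF` and `ΔG` arise in this way.
  quotient : ∀ D E {m n} → Series m n → MatPoly E m n
  quotient D E X = coefficients E (λ d → X (D ℕ.+ d))

  ⟦quotient⟧ : ∀ {D E m n} (X : Series m n) → X ≈[ D ] 0ˢ →
               ⟦ quotient D E X ⟧ ·t^ D ≈[ D ℕ.+ E ] X
  ⟦quotient⟧ {D} {E} X X≈0 = Mod.≈-trans (D ℕ.+ E)
    (·t^-cong D (⟦coefficients⟧ (λ d → X (D ℕ.+ d)))) shift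
    where
    shift : (λ d → X (D ℕ.+ d)) ·t^ D ≈[ D ℕ.+ E ] X
    shift d _ i j with D ℕ.≤? d
    ... | yes D≤d = reflexive (cong (λ e → X e i j) (ℕ.m+[n∸m]≡n D≤d))
    ... | no  D≰d = sym (X≈0 d (ℕ.≰⇒> D≰d) i j)

  -- Applied to `ΔG`, this recovers it from its half `S`.
  half-symmetrization : ∀ {E n} {½ : Carrier} {X : Series n n} → ½ + ½ ≈ 1# →
                        X ᵀ ≈[ E ] X → (½ •ˢ X) ᵀ +ˢ ½ •ˢ X ≈[ E ] X
  half-symmetrization {½ = ½} {X} ½+½≈1 Xᵀ≈X d d<E i j = begin
    ½ * X d j i + ½ * X d i j  ≈⟨ +-congʳ (*-congˡ (Xᵀ≈X d d<E i j)) ⟩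
    ½ * X d i j + ½ * X d i j  ≈⟨ distribʳ (X d i j) ½ ½ ⟨
    (½ + ½) * X d i j          ≈⟨ *-congʳ ½+½≈1 ⟩
    1# * X d i j               ≈⟨ *-identityˡ (X d i j) ⟩
    X d i j                    ∎
    where open ≈

-- Specialization to real coefficients, and existence of the lifting step.

open import Defs
open import Data.Nat.Base using (_+_; _≤_)
open MatrixSeriesProperties ℝ-commutativeRing

½+½≃1 : ½ℝ +ℝ ½ℝ ≃ 1ℝ
-- Both reals are constant sequences of rationals, and the absolute value of their difference
-- computes to 0.
close ½+½≃1 ε ε>0 = 0 , λ _ _ → ε>0

module _ {M N D E : ℕ} (E≤D : E ≤ D)
         (A : MatPoly D M N) (ΔA : MatPoly E M N)
         (Q : MatPoly D M N) (R : MatPoly D N N) where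

  -- The step is specified by relations, so witnesses are needed. The two relations modulo t^D make
  -- the residuals divisible by t^D, invertibility of the constant term gives `R⁻¹`, and the other
  -- quantities are read off from their defining formulas.
  liftingStep : ⟦ Q ⟧ *ˢ ⟦ R ⟧ ≈[ D ] ⟦ A ⟧ →
                ⟦ Q ⟧ ᵀ *ˢ ⟦ Q ⟧ ≈[ D ] 1ˢ →
                Invertible (⟦ truncate E≤D R ⟧ 0) →
                LiftingStep E≤D A ΔA Q R
  liftingStep QR≈A QᵀQ≈1 R₀-invertible = record
    { R⁻¹    = R⁻¹
    ; R-invʳ = ≈-trans (*ˢ-congˡ R[E] (⟦coefficients⟧ (proj₁ R-inverse))) (proj₁ (proj₂ R-inverse))
    ; R-invˡ = ≈-trans (*ˢ-congʳ R[E] (⟦coefficients⟧ (proj₁ R-inverse))) (proj₂ (proj₂ R-inverse))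
    ; ΔF     = ΔF
    ; ΔF-def = ⟦quotient⟧ (⟦ Q ⟧ *ˢ ⟦ R ⟧ -ˢ ⟦ A ⟧) (Mod.x≈y⇒x∙y⁻¹≈ε D QR≈A)
    ; ΔG     = ΔG
    ; ΔG-def = ⟦quotient⟧ (1ˢ -ˢ ⟦ Q ⟧ ᵀ *ˢ ⟦ Q ⟧) (Mod.x≈y⇒x∙y⁻¹≈ε D (Mod.≈-sym D QᵀQ≈1))
    ; H      = H
    ; H-def  = ⟦coefficients⟧ (⟦ ΔA ⟧ -ˢ ⟦ ΔF ⟧)
    ; S      = S
    ; S-def  = ⟦coefficients⟧ (½ℝ •ˢ ⟦ ΔG ⟧)
    ; X      = X
    ; X-anti = X-anti
    ; X-def  = X-def
    ; K      = K
    ; K-def  = ⟦coefficients⟧ (⟦ S ⟧ +ˢ ⟦ X ⟧)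
    ; ΔR     = ΔR
    ; ΔR-def = ⟦coefficients⟧ (Q[E] ᵀ *ˢ ⟦ H ⟧ -ˢ ⟦ K ⟧ *ˢ R[E])
    ; ΔQ     = coefficients E ((⟦ H ⟧ -ˢ Q[E] *ˢ ⟦ ΔR ⟧) *ˢ ⟦ R⁻¹ ⟧)
    ; ΔQ-def = ⟦coefficients⟧ ((⟦ H ⟧ -ˢ Q[E] *ˢ ⟦ ΔR ⟧) *ˢ ⟦ R⁻¹ ⟧)
    }
    where
    open Mod E
    Q[E] = ⟦ truncate E≤D Q ⟧
    R[E] = ⟦ truncate E≤D R ⟧
    R-inverse = inverse R[E] R₀-invertible E
    R⁻¹ = coefficients E (proj₁ R-inverse)
    ΔF = quotient D E (⟦ Q ⟧ *ˢ ⟦ R ⟧ -ˢ ⟦ A ⟧)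
    ΔG = quotient D E (1ˢ -ˢ ⟦ Q ⟧ ᵀ *ˢ ⟦ Q ⟧)
    H = coefficients E (⟦ ΔA ⟧ -ˢ ⟦ ΔF ⟧)
    S = coefficients E (½ℝ •ˢ ⟦ ΔG ⟧)
    QᵀHR⁻¹ = Q[E] ᵀ *ˢ ⟦ H ⟧ *ˢ ⟦ R⁻¹ ⟧
    X̂ : Series N N
    -- `X-def` prescribes exactly the strictly lower part of QᵀHR⁻¹ - S; antisymmetry fills in the
    -- rest.
    X̂ d = antisymmetrize ((QᵀHR⁻¹ -ˢ ⟦ S ⟧) d)
    X = coefficients E X̂
    K = coefficients E (⟦ S ⟧ +ˢ ⟦ X ⟧)
    ΔR = coefficients E (Q[E] ᵀ *ˢ ⟦ H ⟧ -ˢ ⟦ K ⟧ *ˢ R[E])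

    X-anti : ⟦ X ⟧ ᵀ ≈[ E ] -ˢ ⟦ X ⟧
    X-anti = begin
      ⟦ X ⟧ ᵀ    ≈⟨ ᵀ-cong (⟦coefficients⟧ X̂) ⟩
      X̂ ᵀ        ≈⟨ (λ d _ → antisymmetrize-transpose ((QᵀHR⁻¹ -ˢ ⟦ S ⟧) d)) ⟩
      -ˢ X̂       ≈⟨ -ˢ-cong (⟦coefficients⟧ X̂) ⟨
      -ˢ ⟦ X ⟧   ∎

    X-def : P-L ∘ˢ ⟦ X ⟧ ≈[ E ] P-L ∘ˢ QᵀHR⁻¹ -ˢ P-L ∘ˢ ⟦ S ⟧
    X-def = begin
      P-L ∘ˢ ⟦ X ⟧                      ≈⟨ ∘ˢ-cong P-L (⟦coefficients⟧ X̂) ⟩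
      P-L ∘ˢ X̂                          ≈⟨ (λ d _ → antisymmetrize-below ((QᵀHR⁻¹ -ˢ ⟦ S ⟧) d)) ⟩
      P-L ∘ˢ (QᵀHR⁻¹ -ˢ ⟦ S ⟧)          ≈⟨ ∘ˢ-distrib-- P-L QᵀHR⁻¹ ⟦ S ⟧ ⟩
      P-L ∘ˢ QᵀHR⁻¹ -ˢ P-L ∘ˢ ⟦ S ⟧     ∎

  -- Factorization by an arbitrary lifting step.

  module _ (step : LiftingStep E≤D A ΔA Q R) where
    open LiftingStep step

    private
      Q≈ : Q[E] ≈[ E ] ⟦ Q ⟧
      Q≈ = ⟦truncate⟧ E≤D Q

      R≈ : R[E] ≈[ E ] ⟦ R ⟧
      R≈ = ⟦truncate⟧ E≤D R

      A⁺ Q⁺ : Series M N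
      A⁺ = ⟦ A ⟧ +ˢ ⟦ ΔA ⟧ ·t^ D
      Q⁺ = ⟦ Q ⟧ +ˢ ⟦ ΔQ ⟧ ·t^ D
      R⁺ : Series N N
      R⁺ = ⟦ R ⟧ +ˢ ⟦ ΔR ⟧ ·t^ D

    ΔQ*R+Q*ΔR≈H : ⟦ ΔQ ⟧ *ˢ ⟦ R ⟧ +ˢ ⟦ Q ⟧ *ˢ ⟦ ΔR ⟧ ≈[ E ] ⟦ H ⟧
    ΔQ*R+Q*ΔR≈H = begin
      ⟦ ΔQ ⟧ *ˢ ⟦ R ⟧ +ˢ ⟦ Q ⟧ *ˢ ⟦ ΔR ⟧
        ≈⟨ +ˢ-cong (*ˢ-cong ΔQ-def (≈-sym R≈)) (*ˢ-congʳ ⟦ ΔR ⟧ (≈-sym Q≈)) ⟩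
      (⟦ H ⟧ -ˢ Q[E] *ˢ ⟦ ΔR ⟧) *ˢ ⟦ R⁻¹ ⟧ *ˢ R[E] +ˢ Q[E] *ˢ ⟦ ΔR ⟧
        ≈⟨ +ˢ-congʳ (*ˢ-assoc V ⟦ R⁻¹ ⟧ R[E]) ⟩
      (⟦ H ⟧ -ˢ Q[E] *ˢ ⟦ ΔR ⟧) *ˢ (⟦ R⁻¹ ⟧ *ˢ R[E]) +ˢ Q[E] *ˢ ⟦ ΔR ⟧
        ≈⟨ +ˢ-congʳ (≈-trans (*ˢ-congˡ V R-invˡ) (*ˢ-identityʳ V)) ⟩
      ⟦ H ⟧ -ˢ Q[E] *ˢ ⟦ ΔR ⟧ +ˢ Q[E] *ˢ ⟦ ΔR ⟧
        ≈⟨ //-rightDividesˡ (Q[E] *ˢ ⟦ ΔR ⟧) ⟦ H ⟧ ⟩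
      ⟦ H ⟧ ∎
      where
      open Mod E
      V = ⟦ H ⟧ -ˢ Q[E] *ˢ ⟦ ΔR ⟧

    -- The old product already contributes the residual `ΔF` from degree D on, and the first-order
    -- correction `H` replaces it by `ΔA`.
    lifted-factorization : Q⁺ *ˢ R⁺ ≈[ D + E ] A⁺
    lifted-factorization = begin
      Q⁺ *ˢ R⁺
        ≈⟨ lift-*ˢ E≤D ⟦ Q ⟧ ⟦ ΔQ ⟧ ⟦ R ⟧ ⟦ ΔR ⟧ ⟩
      QR +ˢ (⟦ ΔQ ⟧ *ˢ ⟦ R ⟧ +ˢ ⟦ Q ⟧ *ˢ ⟦ ΔR ⟧) ·t^ D
        ≈⟨ +ˢ-cong QR≈A+ΔF (·t^-cong D (Mod.≈-trans E ΔQ*R+Q*ΔR≈H H-def)) ⟩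
      ⟦ A ⟧ +ˢ ⟦ ΔF ⟧ ·t^ D +ˢ (⟦ ΔA ⟧ -ˢ ⟦ ΔF ⟧) ·t^ D
        ≈⟨ +ˢ-assoc ⟦ A ⟧ (⟦ ΔF ⟧ ·t^ D) ((⟦ ΔA ⟧ -ˢ ⟦ ΔF ⟧) ·t^ D) ⟩
      ⟦ A ⟧ +ˢ (⟦ ΔF ⟧ ·t^ D +ˢ (⟦ ΔA ⟧ -ˢ ⟦ ΔF ⟧) ·t^ D)
        ≈⟨ +ˢ-congˡ (·t^-distrib-+ D ⟦ ΔF ⟧ (⟦ ΔA ⟧ -ˢ ⟦ ΔF ⟧)) ⟨
      ⟦ A ⟧ +ˢ (⟦ ΔF ⟧ +ˢ (⟦ ΔA ⟧ -ˢ ⟦ ΔF ⟧)) ·t^ D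
        ≈⟨ +ˢ-congˡ (·t^-cong D (Mod.x+[y-x]≈y E ⟦ ΔF ⟧ ⟦ ΔA ⟧)) ⟩
      A⁺ ∎
      where
      open Mod (D + E)
      QR = ⟦ Q ⟧ *ˢ ⟦ R ⟧
      QR≈A+ΔF : QR ≈[ D + E ] ⟦ A ⟧ +ˢ ⟦ ΔF ⟧ ·t^ D
      QR≈A+ΔF = ≈-sym (≈-trans (+ˢ-congˡ ΔF-def) (x+[y-x]≈y ⟦ A ⟧ QR))

    -- Orthogonality of the lifted Q.

    ΔG-symmetric : ⟦ ΔG ⟧ ᵀ ≈[ E ] ⟦ ΔG ⟧
    ΔG-symmetric = ·t^-cancel D (begin
      ⟦ ΔG ⟧ ᵀ ·t^ D                    ≈⟨ ·t^-ᵀ D ⟦ ΔG ⟧ ⟨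
      (⟦ ΔG ⟧ ·t^ D) ᵀ                  ≈⟨ ᵀ-cong ΔG-def ⟩
      1ˢ ᵀ -ˢ (⟦ Q ⟧ ᵀ *ˢ ⟦ Q ⟧) ᵀ      ≈⟨ +ˢ-cong 1ˢ-ᵀ (-ˢ-cong (*ˢ-ᵀ (⟦ Q ⟧ ᵀ) ⟦ Q ⟧)) ⟩
      1ˢ -ˢ ⟦ Q ⟧ ᵀ *ˢ ⟦ Q ⟧            ≈⟨ ΔG-def ⟨
      ⟦ ΔG ⟧ ·t^ D                      ∎)
      where open Mod (D + E)

    Kᵀ+K≈ΔG : ⟦ K ⟧ ᵀ +ˢ ⟦ K ⟧ ≈[ E ] ⟦ ΔG ⟧
    Kᵀ+K≈ΔG = begin
      ⟦ K ⟧ ᵀ +ˢ ⟦ K ⟧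
        ≈⟨ +ˢ-cong (ᵀ-cong K-def) K-def ⟩
      (⟦ S ⟧ ᵀ +ˢ ⟦ X ⟧ ᵀ) +ˢ (⟦ S ⟧ +ˢ ⟦ X ⟧)
        ≈⟨ +ˢ-interchange (⟦ S ⟧ ᵀ) (⟦ X ⟧ ᵀ) ⟦ S ⟧ ⟦ X ⟧ ⟩
      (⟦ S ⟧ ᵀ +ˢ ⟦ S ⟧) +ˢ (⟦ X ⟧ ᵀ +ˢ ⟦ X ⟧)
        ≈⟨ +ˢ-cong (+ˢ-cong (ᵀ-cong S-def) S-def)
                   (≈-trans (+ˢ-congʳ X-anti) (-ˢ-inverseˡ ⟦ X ⟧)) ⟩
      ((½ℝ •ˢ ⟦ ΔG ⟧) ᵀ +ˢ ½ℝ •ˢ ⟦ ΔG ⟧) +ˢ 0ˢ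
        ≈⟨ +ˢ-identityʳ _ ⟩
      (½ℝ •ˢ ⟦ ΔG ⟧) ᵀ +ˢ ½ℝ •ˢ ⟦ ΔG ⟧
        ≈⟨ half-symmetrization ½+½≃1 ΔG-symmetric ⟩
      ⟦ ΔG ⟧ ∎
      where
      open Mod E

    module _ (QᵀQ≈1 : ⟦ Q ⟧ ᵀ *ˢ ⟦ Q ⟧ ≈[ D ] 1ˢ) where

      -- Since QᵀQ ≈ 1, the product Qᵀ (H - Q ΔR) is QᵀH - ΔR, which equals K R by the choice of
      -- `ΔR`. The factor `R⁻¹` in `ΔQ` then cancels R.
      QᵀΔQ≈K : ⟦ Q ⟧ ᵀ *ˢ ⟦ ΔQ ⟧ ≈[ E ] ⟦ K ⟧
      QᵀΔQ≈K = begin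
        ⟦ Q ⟧ ᵀ *ˢ ⟦ ΔQ ⟧
          ≈⟨ *ˢ-cong (ᵀ-cong (≈-sym Q≈)) ΔQ-def ⟩
        Qᵀ *ˢ ((⟦ H ⟧ -ˢ Q[E] *ˢ ⟦ ΔR ⟧) *ˢ ⟦ R⁻¹ ⟧)
          ≈⟨ *ˢ-assoc Qᵀ (⟦ H ⟧ -ˢ Q[E] *ˢ ⟦ ΔR ⟧) ⟦ R⁻¹ ⟧ ⟨
        Qᵀ *ˢ (⟦ H ⟧ -ˢ Q[E] *ˢ ⟦ ΔR ⟧) *ˢ ⟦ R⁻¹ ⟧
          ≈⟨ *ˢ-congʳ ⟦ R⁻¹ ⟧ QᵀV≈KR ⟩
        ⟦ K ⟧ *ˢ R[E] *ˢ ⟦ R⁻¹ ⟧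
          ≈⟨ *ˢ-assoc ⟦ K ⟧ R[E] ⟦ R⁻¹ ⟧ ⟩
        ⟦ K ⟧ *ˢ (R[E] *ˢ ⟦ R⁻¹ ⟧)
          ≈⟨ *ˢ-congˡ ⟦ K ⟧ R-invʳ ⟩
        ⟦ K ⟧ *ˢ 1ˢ
          ≈⟨ *ˢ-identityʳ ⟦ K ⟧ ⟩
        ⟦ K ⟧ ∎
        where
        open Mod E
        Qᵀ = Q[E] ᵀ

        QᵀQΔR≈ΔR : Qᵀ *ˢ (Q[E] *ˢ ⟦ ΔR ⟧) ≈[ E ] ⟦ ΔR ⟧
        QᵀQΔR≈ΔR = begin
          Qᵀ *ˢ (Q[E] *ˢ ⟦ ΔR ⟧)        ≈⟨ *ˢ-assoc Qᵀ Q[E] ⟦ ΔR ⟧ ⟨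
          Qᵀ *ˢ Q[E] *ˢ ⟦ ΔR ⟧          ≈⟨ *ˢ-congʳ ⟦ ΔR ⟧ (*ˢ-cong (ᵀ-cong Q≈) Q≈) ⟩
          ⟦ Q ⟧ ᵀ *ˢ ⟦ Q ⟧ *ˢ ⟦ ΔR ⟧    ≈⟨ *ˢ-congʳ ⟦ ΔR ⟧ (≈-mono E≤D QᵀQ≈1) ⟩
          1ˢ *ˢ ⟦ ΔR ⟧                  ≈⟨ *ˢ-identityˡ ⟦ ΔR ⟧ ⟩
          ⟦ ΔR ⟧                        ∎

        QᵀV≈KR : Qᵀ *ˢ (⟦ H ⟧ -ˢ Q[E] *ˢ ⟦ ΔR ⟧) ≈[ E ] ⟦ K ⟧ *ˢ R[E]
        QᵀV≈KR = begin
          Qᵀ *ˢ (⟦ H ⟧ -ˢ Q[E] *ˢ ⟦ ΔR ⟧)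
            ≈⟨ *ˢ-distribˡ-- Qᵀ ⟦ H ⟧ (Q[E] *ˢ ⟦ ΔR ⟧) ⟩
          Qᵀ *ˢ ⟦ H ⟧ -ˢ Qᵀ *ˢ (Q[E] *ˢ ⟦ ΔR ⟧)
            ≈⟨ +ˢ-congˡ (-ˢ-cong (≈-trans QᵀQΔR≈ΔR ΔR-def)) ⟩
          Qᵀ *ˢ ⟦ H ⟧ -ˢ (Qᵀ *ˢ ⟦ H ⟧ -ˢ ⟦ K ⟧ *ˢ R[E])
            ≈⟨ x-[x-y]≈y (Qᵀ *ˢ ⟦ H ⟧) (⟦ K ⟧ *ˢ R[E]) ⟩
          ⟦ K ⟧ *ˢ R[E] ∎

      ΔQᵀQ+QᵀΔQ≈ΔG : ⟦ ΔQ ⟧ ᵀ *ˢ ⟦ Q ⟧ +ˢ ⟦ Q ⟧ ᵀ *ˢ ⟦ ΔQ ⟧ ≈[ E ] ⟦ ΔG ⟧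
      ΔQᵀQ+QᵀΔQ≈ΔG = begin
        ⟦ ΔQ ⟧ ᵀ *ˢ ⟦ Q ⟧ +ˢ ⟦ Q ⟧ ᵀ *ˢ ⟦ ΔQ ⟧
          -- The first summand is the transpose of the second, so only QᵀΔQ has to be known.
          ≈⟨ +ˢ-congʳ (*ˢ-ᵀ (⟦ Q ⟧ ᵀ) ⟦ ΔQ ⟧) ⟨
        (⟦ Q ⟧ ᵀ *ˢ ⟦ ΔQ ⟧) ᵀ +ˢ ⟦ Q ⟧ ᵀ *ˢ ⟦ ΔQ ⟧
          ≈⟨ +ˢ-cong (ᵀ-cong QᵀΔQ≈K) QᵀΔQ≈K ⟩
        ⟦ K ⟧ ᵀ +ˢ ⟦ K ⟧
          ≈⟨ Kᵀ+K≈ΔG ⟩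
        ⟦ ΔG ⟧ ∎
        where open Mod E

      lifted-orthogonality : Q⁺ ᵀ *ˢ Q⁺ ≈[ D + E ] 1ˢ
      lifted-orthogonality = begin
        Q⁺ ᵀ *ˢ Q⁺
          ≈⟨ *ˢ-congʳ Q⁺ (+ˢ-congˡ {x = ⟦ Q ⟧ ᵀ} (·t^-ᵀ D ⟦ ΔQ ⟧)) ⟩
        (⟦ Q ⟧ ᵀ +ˢ ⟦ ΔQ ⟧ ᵀ ·t^ D) *ˢ Q⁺
          ≈⟨ lift-*ˢ E≤D (⟦ Q ⟧ ᵀ) (⟦ ΔQ ⟧ ᵀ) ⟦ Q ⟧ ⟦ ΔQ ⟧ ⟩
        QᵀQ +ˢ (⟦ ΔQ ⟧ ᵀ *ˢ ⟦ Q ⟧ +ˢ ⟦ Q ⟧ ᵀ *ˢ ⟦ ΔQ ⟧) ·t^ D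
          ≈⟨ +ˢ-congˡ (·t^-cong D ΔQᵀQ+QᵀΔQ≈ΔG) ⟩
        QᵀQ +ˢ ⟦ ΔG ⟧ ·t^ D
          ≈⟨ +ˢ-congˡ ΔG-def ⟩
        QᵀQ +ˢ (1ˢ -ˢ QᵀQ)
          ≈⟨ x+[y-x]≈y QᵀQ 1ˢ ⟩
        1ˢ ∎
        where
        open Mod (D + E)
        QᵀQ = ⟦ Q ⟧ ᵀ *ˢ ⟦ Q ⟧

    -- Triangularity of the lifted R.

    module _ (R-upper : P-L ∘ˢ ⟦ R ⟧ ≈[ D ] 0ˢ) where

      ΔR-upper : P-L ∘ˢ ⟦ ΔR ⟧ ≈[ E ] 0ˢ
      ΔR-upper = begin
        P-L ∘ˢ ⟦ ΔR ⟧
          ≈⟨ ∘ˢ-cong P-L ΔR≈ ⟩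
        P-L ∘ˢ ((QᵀHR⁻¹ -ˢ ⟦ K ⟧) *ˢ ⟦ R ⟧)
          ≈⟨ upper-triangular-*ˢ {Y = ⟦ R ⟧} QᵀHR⁻¹-K-upper (≈-mono E≤D R-upper) ⟩
        0ˢ ∎
        where
        open Mod E
        QᵀH = Q[E] ᵀ *ˢ ⟦ H ⟧
        QᵀHR⁻¹ = QᵀH *ˢ ⟦ R⁻¹ ⟧

        ΔR≈ : ⟦ ΔR ⟧ ≈[ E ] (QᵀHR⁻¹ -ˢ ⟦ K ⟧) *ˢ ⟦ R ⟧
        ΔR≈ = begin
          ⟦ ΔR ⟧
            ≈⟨ ΔR-def ⟩
          QᵀH -ˢ ⟦ K ⟧ *ˢ R[E]
            -- Inserting R⁻¹R after QᵀH exposes R as a common right factor.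
            ≈⟨ +ˢ-congʳ (≈-trans (*ˢ-congˡ QᵀH R-invˡ) (*ˢ-identityʳ QᵀH)) ⟨
          QᵀH *ˢ (⟦ R⁻¹ ⟧ *ˢ R[E]) -ˢ ⟦ K ⟧ *ˢ R[E]
            ≈⟨ +ˢ-congʳ (*ˢ-assoc QᵀH ⟦ R⁻¹ ⟧ R[E]) ⟨
          QᵀHR⁻¹ *ˢ R[E] -ˢ ⟦ K ⟧ *ˢ R[E]
            ≈⟨ *ˢ-distribʳ-- QᵀHR⁻¹ ⟦ K ⟧ R[E] ⟨
          (QᵀHR⁻¹ -ˢ ⟦ K ⟧) *ˢ R[E]
            ≈⟨ *ˢ-congˡ (QᵀHR⁻¹ -ˢ ⟦ K ⟧) R≈ ⟩
          (QᵀHR⁻¹ -ˢ ⟦ K ⟧) *ˢ ⟦ R ⟧ ∎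

        QᵀHR⁻¹-K-upper : P-L ∘ˢ (QᵀHR⁻¹ -ˢ ⟦ K ⟧) ≈[ E ] 0ˢ
        QᵀHR⁻¹-K-upper = begin
          P-L ∘ˢ (QᵀHR⁻¹ -ˢ ⟦ K ⟧)
            ≈⟨ ∘ˢ-distrib-- P-L QᵀHR⁻¹ ⟦ K ⟧ ⟩
          P-L ∘ˢ QᵀHR⁻¹ -ˢ P-L ∘ˢ ⟦ K ⟧
            ≈⟨ x≈y⇒x∙y⁻¹≈ε (≈-sym P-L∘K≈) ⟩
          0ˢ ∎
          where
          -- The lower part of `S` subtracted in `X-def` is restored by K = S + X.
          P-L∘K≈ : P-L ∘ˢ ⟦ K ⟧ ≈[ E ] P-L ∘ˢ QᵀHR⁻¹
          P-L∘K≈ = begin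
            P-L ∘ˢ ⟦ K ⟧
              ≈⟨ ∘ˢ-cong P-L K-def ⟩
            P-L ∘ˢ (⟦ S ⟧ +ˢ ⟦ X ⟧)
              ≈⟨ ∘ˢ-distrib-+ P-L ⟦ S ⟧ ⟦ X ⟧ ⟩
            P-L ∘ˢ ⟦ S ⟧ +ˢ P-L ∘ˢ ⟦ X ⟧
              ≈⟨ +ˢ-congˡ X-def ⟩
            P-L ∘ˢ ⟦ S ⟧ +ˢ (P-L ∘ˢ QᵀHR⁻¹ -ˢ P-L ∘ˢ ⟦ S ⟧)
              ≈⟨ x+[y-x]≈y (P-L ∘ˢ ⟦ S ⟧) (P-L ∘ˢ QᵀHR⁻¹) ⟩
            P-L ∘ˢ QᵀHR⁻¹ ∎

      lifted-triangularity : P-L ∘ˢ R⁺ ≈[ D + E ] 0ˢ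
      lifted-triangularity = begin
        P-L ∘ˢ R⁺
          ≈⟨ ∘ˢ-distrib-+ P-L ⟦ R ⟧ (⟦ ΔR ⟧ ·t^ D) ⟩
        P-L ∘ˢ ⟦ R ⟧ +ˢ P-L ∘ˢ (⟦ ΔR ⟧ ·t^ D)
          ≈⟨ +ˢ-cong (upper-triangular-⟦⟧ R R-upper) (∘ˢ-·t^ D P-L ⟦ ΔR ⟧) ⟩
        0ˢ +ˢ (P-L ∘ˢ ⟦ ΔR ⟧) ·t^ D
          ≈⟨ +ˢ-identityˡ _ ⟩
        (P-L ∘ˢ ⟦ ΔR ⟧) ·t^ D
          ≈⟨ ·t^-cong D ΔR-upper ⟩
        0ˢ ·t^ D
          ≈⟨ 0ˢ-·t^ D ⟩
        0ˢ ∎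
        where open Mod (D + E)

mainTheorem1 :
  ∀ {M N D E : ℕ} → N ≤ M → 1 ≤ N → 1 ≤ E → (E≤D : E ≤ D) →
  (A : MatPoly D M N) (ΔA : MatPoly E M N)
  (Q : MatPoly D M N) (R : MatPoly D N N) →
  ⟦ Q ⟧ *ˢ ⟦ R ⟧ ≈[ D ] ⟦ A ⟧ →
  ⟦ Q ⟧ ᵀ *ˢ ⟦ Q ⟧ ≈[ D ] 1ˢ →
  P-L ∘ˢ ⟦ R ⟧ ≈[ D ] 0ˢ →
  Invertible (⟦ R ⟧ 0) →
  LiftingStep E≤D A ΔA Q R ×
  ((step : LiftingStep E≤D A ΔA Q R) →
   let open LiftingStep step
       A⁺ = ⟦ A ⟧ +ˢ ⟦ ΔA ⟧ ·t^ D
       Q⁺ = ⟦ Q ⟧ +ˢ ⟦ ΔQ ⟧ ·t^ D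
       R⁺ = ⟦ R ⟧ +ˢ ⟦ ΔR ⟧ ·t^ D
   in (Q⁺ *ˢ R⁺ ≈[ D + E ] A⁺) ×
      (Q⁺ ᵀ *ˢ Q⁺ ≈[ D + E ] 1ˢ) ×
      (P-L ∘ˢ R⁺ ≈[ D + E ] 0ˢ))
mainTheorem1 _ _ 1≤E E≤D A ΔA Q R QR≈A QᵀQ≈1 R-upper R₀-invertible =
  liftingStep E≤D A ΔA Q R QR≈A QᵀQ≈1
    -- Because E is at least 1, truncation keeps the constant term, so the truncated R has the same
    -- invertible R₀.
    (Invertible-cong (λ i j → Mod.≈-sym _ (⟦truncate⟧ E≤D R) 0 1≤E i j) R₀-invertible) ,
  λ step → lifted-factorization E≤D A ΔA Q R step
         , lifted-orthogonality E≤D A ΔA Q R step QᵀQ≈1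
         , lifted-triangularity E≤D A ΔA Q R step R-upper
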